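{- If $M$ is any nonstandard model of $\mathrm{PA}$, then every countable model of set theory is isomorphic to a submodel of the hereditarily finite sets $\langle \mathrm{HF}^M,\in^M\rangle$ of $M$. Indeed, $\langle \mathrm{HF}^M,\in^M\rangle$ is universal for all countable acyclic binary relations: for every countable set $G$ with an acyclic binary relation $\rightharpoonup$ on it, the structure $\langle G,\rightharpoonup\rangle$ is isomorphic to a submodel of $\langle \mathrm{HF}^M,\in^M\rangle$.
   Context: For a model $M$ of arithmetic, $\langle\mathrm{HF}^M,\in^M\rangle$ is the structure obtained in $M$ by Ackermann coding: its elements are the elements of $M$, and $n\in^M m$ holds iff $M$ satisfies "the $n$-th binary bit of $m$ is $1$". A binary relation $\rightharpoonup$ on $G$ is acyclic if there is no finite directed path (of length at least one) from a point of $G$ to itself. A submodel of a structure with a binary relation is an arbitrary subset with the restricted relation (an induced substructure). A model of set theory is a first-order structure $\langle N,\in^N\rangle$ satisfying at least the Kripke–Platek axioms KP; it need not be well-founded. -}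

module Defs where

open import Level using () renaming (suc to lsuc)
open import Data.Empty.Polymorphic using (⊥)
open import Data.Fin.Base using (Fin; zero; suc)
open import Data.Nat.Base using (ℕ; zero; suc)
open import Data.Product.Base using (_×_; ∃-syntax)
open import Data.Refinement using (Refinement; value)
open import Data.Sum.Base using (_⊎_)
open import Data.Vec.Base using (Vec; []; _∷_; lookup)
open import Function.Base using (_on_)
open import Function.Bundles using (_↣_; _⇔_)
open import Relation.Binary.Core using (Rel)
open import Relation.Binary.Construct.Closure.Transitive using (TransClosure)
open import Relation.Binary.Morphism.Structures using (IsOrderIsomorphism)
open import Relation.Binary.PropositionalEquality.Core using (_≡_; _≢_)
open import Relation.Nullary.Negation.Core using (¬_)
open import Relation.Unary using (Pred)

infix  8 all_ ex_
infixr 7 _∧_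
infixr 6 _∨_
infixr 5 _⇒_

-- Formulas with free variables among n de Bruijn indices; At n is the
-- type of atomic formulas in these variables.
data Formula (At : ℕ → Set) : ℕ → Set where
  atom        : ∀ {n} → At n → Formula At n
  false       : ∀ {n} → Formula At n
  _∧_ _∨_ _⇒_ : ∀ {n} → Formula At n → Formula At n → Formula At n
  all_ ex_    : ∀ {n} → Formula At (suc n) → Formula At n

module Semantics {ℓ} {At : ℕ → Set} {A : Set ℓ}
                 (⟦_⟧ᵃ : ∀ {n} → At n → Vec A n → Set ℓ) where

  Sat : ∀ {n} → Formula At n → Vec A n → Set ℓ
  Sat (atom α) ρ = ⟦ α ⟧ᵃ ρ
  Sat false    ρ = ⊥
  Sat (φ ∧ ψ)  ρ = Sat φ ρ × Sat ψ ρ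
  Sat (φ ∨ ψ)  ρ = Sat φ ρ ⊎ Sat ψ ρ
  Sat (φ ⇒ ψ)  ρ = Sat φ ρ → Sat ψ ρ
  Sat (all φ)  ρ = ∀ a → Sat φ (a ∷ ρ)
  Sat (ex φ)   ρ = ∃[ a ] Sat φ (a ∷ ρ)

infix  8 _≐_
infixl 9 _+'_
infixl 10 _·'_

data Term (n : ℕ) : Set where
  var       : Fin n → Term n
  O         : Term n
  S         : Term n → Term n
  _+'_ _·'_ : Term n → Term n → Term n

data ArithAtom (n : ℕ) : Set where
  _≐_ : Term n → Term n → ArithAtom n

ArithFormula : ℕ → Set
ArithFormula = Formula ArithAtom

record ArithStructure ℓ : Set (lsuc ℓ) where
  infixl 6 _+_
  infixl 7 _·_
  field
    Carrier : Set ℓ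
    0#      : Carrier
    S#      : Carrier → Carrier
    _+_     : Carrier → Carrier → Carrier
    _·_     : Carrier → Carrier → Carrier

  ⟦_⟧ : ∀ {n} → Term n → Vec Carrier n → Carrier
  ⟦ var i ⟧  ρ = lookup ρ i
  ⟦ O ⟧      ρ = 0#
  ⟦ S t ⟧    ρ = S# (⟦ t ⟧ ρ)
  ⟦ s +' t ⟧ ρ = ⟦ s ⟧ ρ + ⟦ t ⟧ ρ
  ⟦ s ·' t ⟧ ρ = ⟦ s ⟧ ρ · ⟦ t ⟧ ρ

  ⟦_⟧ᵃ : ∀ {n} → ArithAtom n → Vec Carrier n → Set ℓ
  ⟦ s ≐ t ⟧ᵃ ρ = ⟦ s ⟧ ρ ≡ ⟦ t ⟧ ρ

  open Semantics ⟦_⟧ᵃ public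

  numeral : ℕ → Carrier
  numeral zero    = 0#
  numeral (suc n) = S# (numeral n)

-- Induction is the full first-order schema: φ ranges over all formulas,
-- variable 0 is the induction variable and ρ interprets the parameters.

record IsPAModel {ℓ} (M : ArithStructure ℓ) : Set ℓ where
  open ArithStructure M
  field
    S≢0       : ∀ x → S# x ≢ 0#
    S-inj     : ∀ x y → S# x ≡ S# y → x ≡ y
    +-zero    : ∀ x → x + 0# ≡ x
    +-suc     : ∀ x y → x + S# y ≡ S# (x + y)
    ·-zero    : ∀ x → x · 0# ≡ 0#
    ·-suc     : ∀ x y → x · S# y ≡ x · y + x
    induction : ∀ {n} (φ : ArithFormula (suc n)) (ρ : Vec Carrier n) →
                Sat φ (0# ∷ ρ) →
                (∀ x → Sat φ (x ∷ ρ) → Sat φ (S# x ∷ ρ)) →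
                ∀ x → Sat φ (x ∷ ρ)

Nonstandard : ∀ {ℓ} → ArithStructure ℓ → Set ℓ
Nonstandard M = ∃[ c ] (∀ (n : ℕ) → c ≢ numeral n)
  where open ArithStructure M

wk : ∀ {n} → Term n → Term (suc n)
wk (var i)  = var (suc i)
wk O        = O
wk (S t)    = S (wk t)
wk (s +' t) = wk s +' wk t
wk (s ·' t) = wk s ·' wk t

v₀ : ∀ {n} → Term (suc n)
v₀ = var zero

v₁ : ∀ {n} → Term (suc (suc n))
v₁ = wk v₀

v₂ : ∀ {n} → Term (suc (suc (suc n)))
v₂ = wk v₁

infix 8 _<'_

_<'_ : ∀ {n} → Term n → Term n → ArithFormula n
s <' t = ex (atom (wk s +' S v₀ ≐ wk t))

-- Gödel's β-function: v is the remainder of a modulo 1 + (1 + i) · b.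
Beta : ∀ {n} → (a b i v : Term n) → ArithFormula n
Beta a b i v = v <' d ∧ ex (atom (v₀ ·' wk d +' wk v ≐ wk a))
  where d = S (S i ·' b)

-- p = 2ⁱ: some β-coded sequence (a , b) starts with 1, doubles at each
-- step below i, and has the value p at i.
Pow2 : ∀ {n} → (i p : Term n) → ArithFormula n
Pow2 i p = ex ex
  ( Beta v₁ v₀ O (S O)
  ∧ all (v₀ <' wk (wk (wk i)) ⇒
      ex (Beta (wk v₂) (wk v₁) v₁ v₀ ∧ Beta (wk v₂) (wk v₁) (S v₁) (v₀ +' v₀)))
  ∧ Beta v₁ v₀ (wk (wk i)) (wk (wk p)))

-- The i-th binary bit of m is 1: m = (2q + 1) · p + r with p = 2ⁱ and
-- r < p.  The bound variables p, q, r are v₂, v₁, v₀.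
Bit : ∀ {n} → (i m : Term n) → ArithFormula n
Bit i m = ex ex ex
  ( Pow2 (wk (wk (wk i))) v₂
  ∧ v₀ <' v₂
  ∧ atom (wk (wk (wk m)) ≐ S (v₁ +' v₁) ·' v₂ +' v₀))

record BinaryStructure ℓ : Set (lsuc ℓ) where
  infix 4 _⇀_
  field
    Carrier : Set ℓ
    _⇀_     : Rel Carrier ℓ

-- Ackermann coding: n ⇀ m iff M satisfies that the n-th bit of m is 1.
HF : ∀ {ℓ} → ArithStructure ℓ → BinaryStructure ℓ
HF M = record
  { Carrier = Carrier
  ; _⇀_     = λ n m → Sat (Bit v₀ v₁) (n ∷ m ∷ [])
  } where open ArithStructure M

Countable : ∀ {ℓ} → BinaryStructure ℓ → Set ℓ
Countable G = BinaryStructure.Carrier G ↣ ℕ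

Acyclic : ∀ {ℓ} → BinaryStructure ℓ → Set ℓ
Acyclic G = ∀ x → ¬ TransClosure _⇀_ x x
  where open BinaryStructure G

-- Membership proofs in a Refinement are irrelevant, so equality in the
-- submodel is equality of the underlying elements.
Submodel : ∀ {ℓ} (B : BinaryStructure ℓ) → Pred (BinaryStructure.Carrier B) ℓ →
           BinaryStructure ℓ
Submodel B P = record
  { Carrier = Refinement Carrier P
  ; _⇀_     = _⇀_ on value
  } where open BinaryStructure B

infix 4 _≅_

_≅_ : ∀ {ℓ} → BinaryStructure ℓ → BinaryStructure ℓ → Set ℓ
A ≅ B = ∃[ f ] IsOrderIsomorphism _≡_ _≡_ A._⇀_ B._⇀_ f
  where
  module A = BinaryStructure A
  module B = BinaryStructure B

IsomorphicToSubmodel : ∀ {ℓ} → BinaryStructure ℓ → BinaryStructure ℓ → Set (lsuc ℓ)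
IsomorphicToSubmodel A B = ∃[ P ] A ≅ Submodel B P

infix 8 _≈'_ _∈'_

data SetAtom (n : ℕ) : Set where
  _≈'_ _∈'_ : Fin n → Fin n → SetAtom n

SetFormula : ℕ → Set
SetFormula = Formula SetAtom

-- In the bounded quantifiers the bound is the variable i of the context
-- outside the quantifier.
data Δ₀ : ∀ {n} → SetFormula n → Set where
  atom  : ∀ {n} (α : SetAtom n) → Δ₀ (atom α)
  false : ∀ {n} → Δ₀ {n} false
  _∧_   : ∀ {n} {φ ψ : SetFormula n} → Δ₀ φ → Δ₀ ψ → Δ₀ (φ ∧ ψ)
  _∨_   : ∀ {n} {φ ψ : SetFormula n} → Δ₀ φ → Δ₀ ψ → Δ₀ (φ ∨ ψ)
  _⇒_   : ∀ {n} {φ ψ : SetFormula n} → Δ₀ φ → Δ₀ ψ → Δ₀ (φ ⇒ ψ)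
  all∈  : ∀ {n} (i : Fin n) {φ : SetFormula (suc n)} → Δ₀ φ →
          Δ₀ (all (atom (zero ∈' suc i) ⇒ φ))
  ex∈   : ∀ {n} (i : Fin n) {φ : SetFormula (suc n)} → Δ₀ φ →
          Δ₀ (ex (atom (zero ∈' suc i) ∧ φ))

module SetSemantics {ℓ} (N : BinaryStructure ℓ) where
  open BinaryStructure N public renaming (_⇀_ to infix 4 _∈_)

  ⟦_⟧ᵃ : ∀ {n} → SetAtom n → Vec Carrier n → Set ℓ
  ⟦ i ≈' j ⟧ᵃ ρ = lookup ρ i ≡ lookup ρ j
  ⟦ i ∈' j ⟧ᵃ ρ = lookup ρ i ∈ lookup ρ j

  open Semantics ⟦_⟧ᵃ public

-- In the schemas ρ interprets the parameters of φ.
record IsKPModel {ℓ} (N : BinaryStructure ℓ) : Set ℓ where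
  open SetSemantics N
  field
    extensionality : ∀ x y → (∀ z → z ∈ x ⇔ z ∈ y) → x ≡ y
    emptySet       : ∃[ x ] (∀ z → ¬ z ∈ x)
    pairing        : ∀ x y → ∃[ p ] (∀ z → z ∈ p ⇔ (z ≡ x ⊎ z ≡ y))
    union          : ∀ x → ∃[ u ] (∀ z → z ∈ u ⇔ (∃[ y ] (y ∈ x × z ∈ y)))
    foundation     : ∀ {n} (φ : SetFormula (suc n)) (ρ : Vec Carrier n) →
                     (∃[ x ] Sat φ (x ∷ ρ)) →
                     ∃[ x ] (Sat φ (x ∷ ρ) × (∀ y → y ∈ x → ¬ Sat φ (y ∷ ρ)))
    Δ₀-separation  : ∀ {n} (φ : SetFormula (suc n)) → Δ₀ φ → (ρ : Vec Carrier n) →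
                     ∀ a → ∃[ b ] (∀ x → x ∈ b ⇔ (x ∈ a × Sat φ (x ∷ ρ)))
    -- In φ, variable 0 is the value y and variable 1 the argument x.
    Δ₀-collection  : ∀ {n} (φ : SetFormula (suc (suc n))) → Δ₀ φ → (ρ : Vec Carrier n) →
                     ∀ a → (∀ x → x ∈ a → ∃[ y ] Sat φ (y ∷ x ∷ ρ)) →
                     ∃[ b ] (∀ x → x ∈ a → ∃[ y ] (y ∈ b × Sat φ (y ∷ x ∷ ρ)))

{-# OPTIONS --safe #-}
module Submission where

-- Let c be nonstandard, T 0 = c and T (i+1) = 2^(T i) for i < c in M.
-- Enumerate the vertices by ℕ, and give the n-th vertex
--   * a standard label sₙ whose bits at the positions sₘ, m < n, say which
--     earlier vertices are adjacent to it (the universality of the Rado graph);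
--   * a level lₙ ≤ c such that paths raise the level by nonstandard amounts
--     (a nonstandard gap splits into two).
-- Its code is the number jₙ < 2^(T lₙ) with jₙ ≡ c + sₙ mod 2ᶜ whose bits i in
-- [c , T lₙ) are 1 iff i ≡ c + r mod 2ᶜ for some r < c that is adjacent to sₙ in
-- the Rado graph.  An edge x ⇀ y gives jₓ < 2^(T lₓ) ≤ T l_y, hence jₓ ∈ j_y.
-- Conversely jₓ ∈ j_y makes x and y adjacent, and y ⇀ x is excluded because it
-- would give j_y < jₓ < j_y.  A model of KP is acyclic by foundation for the
-- finite class of the vertices of a cycle.

open import Defs
open import Algebra.Bundles using (CommutativeSemiring)
import Algebra.Solver.Ring.NaturalCoefficients.Default as NatSolver
open import Axiom.ExcludedMiddle using (ExcludedMiddle)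
open import Data.Empty using (⊥-elim-irr)
open import Data.Fin.Base using (Fin; zero; suc)
open import Data.Irrelevant using () renaming ([_] to irr)
open import Data.Nat.Base as ℕ using (ℕ; zero; suc)
import Data.Nat.Properties as ℕ
open import Data.Product.Base using (_×_; _,_; ∃-syntax; proj₁; proj₂)
import Data.Refinement as Refinement
open import Data.Sum.Base as Sum using (_⊎_; inj₁; inj₂)
open import Data.Vec.Base using (Vec; []; _∷_; lookup)
open import Function.Base using (_∘_; flip; id)
open import Function.Bundles using (Injection)
open import Relation.Binary.Construct.Closure.Transitive using (TransClosure; [_]; _∷_; _++_)
open import Relation.Binary.Definitions using (tri<; tri≈; tri>)
open import Relation.Binary.PropositionalEquality
open import Relation.Nullary.Decidable.Core using (Dec; yes; no)
open import Relation.Nullary.Negation.Core using (¬_; contradiction)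

-- Arithmetic in a model of PA: semiring laws, order, division with remainder.

v₃ : ∀ {n} → Term (suc (suc (suc (suc n))))
v₃ = wk v₂

v₄ : ∀ {n} → Term (suc (suc (suc (suc (suc n)))))
v₄ = wk v₃

v₅ : ∀ {n} → Term (suc (suc (suc (suc (suc (suc n))))))
v₅ = wk v₄

v₆ : ∀ {n} → Term (suc (suc (suc (suc (suc (suc (suc n)))))))
v₆ = wk v₅

v₇ : ∀ {n} → Term (suc (suc (suc (suc (suc (suc (suc (suc n))))))))
v₇ = wk v₆

v₈ : ∀ {n} → Term (suc (suc (suc (suc (suc (suc (suc (suc (suc n)))))))))
v₈ = wk v₇

module Arithmetic {ℓ} (M : ArithStructure ℓ) (isPA : IsPAModel M) where
  open ArithStructure M public renaming (Carrier to C)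
  open IsPAModel isPA public

  1# : C
  1# = S# 0#

  +-zeroˡ : ∀ x → 0# + x ≡ x
  -- Here and below, `Sat` of the induction formula computes to the statement wanted, so base and
  -- step are ordinary proofs.
  +-zeroˡ = induction (atom (O +' v₀ ≐ v₀)) [] (+-zero 0#)
    λ x e → trans (+-suc 0# x) (cong S# e)

  +-sucˡ : ∀ x y → S# x + y ≡ S# (x + y)
  +-sucˡ x = induction (atom (S v₁ +' v₀ ≐ S (v₁ +' v₀))) (x ∷ [])
    (trans (+-zero _) (cong S# (sym (+-zero x))))
    λ y e → trans (+-suc _ y) (cong S# (trans e (sym (+-suc x y))))

  +-comm : ∀ x y → x + y ≡ y + x
  +-comm x = induction (atom (v₁ +' v₀ ≐ v₀ +' v₁)) (x ∷ [])
    (trans (+-zero x) (sym (+-zeroˡ x)))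
    λ y e → trans (+-suc x y) (trans (cong S# e) (sym (+-sucˡ y x)))

  +-assoc : ∀ x y z → (x + y) + z ≡ x + (y + z)
  +-assoc x y = induction (atom ((v₁ +' v₂) +' v₀ ≐ v₁ +' (v₂ +' v₀))) (x ∷ y ∷ [])
    (trans (+-zero _) (cong (x +_) (sym (+-zero y))))
    λ z e → trans (+-suc _ z) (trans (cong S# e)
              (trans (sym (+-suc x _)) (cong (x +_) (sym (+-suc y z)))))

  ·-distribˡ : ∀ x y z → x · (y + z) ≡ x · y + x · z
  ·-distribˡ x y = induction (atom (v₁ ·' (v₂ +' v₀) ≐ v₁ ·' v₂ +' v₁ ·' v₀)) (x ∷ y ∷ [])
    (trans (cong (x ·_) (+-zero y)) (sym (trans (cong (x · y +_) (·-zero x)) (+-zero _))))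
    λ z e → begin
      x · (y + S# z)        ≡⟨ cong (x ·_) (+-suc y z) ⟩
      x · S# (y + z)        ≡⟨ ·-suc x _ ⟩
      x · (y + z) + x       ≡⟨ cong (_+ x) e ⟩
      (x · y + x · z) + x   ≡⟨ +-assoc _ _ x ⟩
      x · y + (x · z + x)   ≡⟨ cong (x · y +_) (·-suc x z) ⟨
      x · y + x · S# z      ∎
    where open ≡-Reasoning

  ·-zeroˡ : ∀ x → 0# · x ≡ 0#
  ·-zeroˡ = induction (atom (O ·' v₀ ≐ O)) [] (·-zero 0#)
    λ x e → trans (·-suc 0# x) (trans (+-zero _) e)

  ·-sucˡ : ∀ x y → S# x · y ≡ x · y + y
  ·-sucˡ x = induction (atom (S v₁ ·' v₀ ≐ v₁ ·' v₀ +' v₀)) (x ∷ [])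
    (trans (·-zero _) (sym (trans (+-zero _) (·-zero x))))
    λ y e → begin
      S# x · S# y           ≡⟨ ·-suc _ y ⟩
      S# x · y + S# x       ≡⟨ +-suc _ x ⟩
      S# (S# x · y + x)     ≡⟨ cong (λ u → S# (u + x)) e ⟩
      S# (x · y + y + x)    ≡⟨ cong S# (trans (+-assoc _ y x)
                                 (trans (cong (x · y +_) (+-comm y x)) (sym (+-assoc _ x y)))) ⟩
      S# (x · y + x + y)    ≡⟨ cong (λ u → S# (u + y)) (·-suc x y) ⟨
      S# (x · S# y + y)     ≡⟨ +-suc _ y ⟨
      x · S# y + S# y       ∎
    where open ≡-Reasoning

  ·-comm : ∀ x y → x · y ≡ y · x
  ·-comm x = induction (atom (v₁ ·' v₀ ≐ v₀ ·' v₁)) (x ∷ [])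
    (trans (·-zero x) (sym (·-zeroˡ x)))
    λ y e → trans (·-suc x y) (trans (cong (_+ x) e) (sym (·-sucˡ y x)))

  ·-assoc : ∀ x y z → (x · y) · z ≡ x · (y · z)
  ·-assoc x y = induction (atom ((v₁ ·' v₂) ·' v₀ ≐ v₁ ·' (v₂ ·' v₀))) (x ∷ y ∷ [])
    (trans (·-zero _) (sym (trans (cong (x ·_) (·-zero y)) (·-zero x))))
    λ z e → trans (·-suc _ z) (trans (cong (_+ x · y) e)
              (trans (sym (·-distribˡ x _ y)) (cong (x ·_) (sym (·-suc y z)))))

  ·-identityʳ : ∀ x → x · 1# ≡ x
  ·-identityʳ x = trans (·-suc x 0#) (trans (cong (_+ x) (·-zero x)) (+-zeroˡ x))

  ·-identityˡ : ∀ x → 1# · x ≡ x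
  ·-identityˡ x = trans (·-comm _ x) (·-identityʳ x)

  commutativeSemiring : CommutativeSemiring ℓ ℓ
  commutativeSemiring = record
    { Carrier = C ; _≈_ = _≡_ ; _+_ = _+_ ; _*_ = _·_ ; 0# = 0# ; 1# = 1#
    ; isCommutativeSemiring = record
      { isSemiring = record
        { isSemiringWithoutAnnihilatingZero = record
          { +-isCommutativeMonoid = record
            { isMonoid = record
              { isSemigroup = record
                { isMagma = record { isEquivalence = isEquivalence ; ∙-cong = cong₂ _+_ }
                ; assoc = +-assoc }
              ; identity = +-zeroˡ , +-zero }
            ; comm = +-comm }
          ; *-cong = cong₂ _·_
          ; *-assoc = ·-assoc
          ; *-identity = ·-identityˡ , ·-identityʳ
          ; distrib = ·-distribˡ , λ x y z →
              trans (·-comm _ x) (trans (·-distribˡ x y z) (cong₂ _+_ (·-comm x y) (·-comm x z))) }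
        ; zero = ·-zeroˡ , ·-zero }
      ; *-comm = ·-comm } }

  open NatSolver commutativeSemiring public using (solve; con; _:+_; _:*_; _:=_)

  S≡ : ∀ x → S# x ≡ x + 1#
  S≡ x = sym (trans (+-suc x 0#) (cong S# (+-zero x)))

  +-cancelʳ : ∀ x y z → x + z ≡ y + z → x ≡ y
  +-cancelʳ x y = induction (atom (v₁ +' v₀ ≐ v₂ +' v₀) ⇒ atom (v₁ ≐ v₂)) (x ∷ y ∷ [])
    (λ e → trans (sym (+-zero x)) (trans e (+-zero y)))
    λ z h e → h (S-inj _ _ (trans (sym (+-suc x z)) (trans e (+-suc y z))))

  +-cancelˡ : ∀ z x y → z + x ≡ z + y → x ≡ y
  +-cancelˡ z x y e = +-cancelʳ x y z (trans (+-comm x z) (trans e (+-comm z y)))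

  0⊎S : ∀ x → x ≡ 0# ⊎ (∃[ y ] x ≡ S# y)
  0⊎S = induction (atom (v₀ ≐ O) ∨ ex (atom (v₁ ≐ S v₀))) [] (inj₁ refl) λ x _ → inj₂ (x , refl)

  infix 4 _<_ _≤_

  -- Shaped like the formula `_<'_`, so that an inequality inside an induction formula computes to
  -- this type.
  _<_ : C → C → Set ℓ
  x < y = ∃[ z ] x + S# z ≡ y

  _≤_ : C → C → Set ℓ
  x ≤ y = ∃[ z ] x + z ≡ y

  -- The semiring solver works with `1#` rather than `S#`; this and `<-elim` convert the witness.
  <-intro : ∀ {x y} z → x + z + 1# ≡ y → x < y
  <-intro {x} z e = z , trans (trans (cong (x +_) (S≡ z)) (sym (+-assoc x z 1#))) e

  <-elim : ∀ {x y} → x < y → ∃[ z ] x + z + 1# ≡ y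
  <-elim {x} (z , e) = z , trans (trans (+-assoc x z 1#) (cong (x +_) (sym (S≡ z)))) e

  m+n≡0⇒n≡0 : ∀ x y → x + y ≡ 0# → y ≡ 0#
  m+n≡0⇒n≡0 x y e with 0⊎S y
  ... | inj₁ y≡0 = y≡0
  ... | inj₂ (z , refl) = contradiction (trans (sym (+-suc x z)) e) (S≢0 _)

  ≤-refl : ∀ {x} → x ≤ x
  ≤-refl {x} = 0# , +-zero x

  ≤-reflexive : ∀ {x y} → x ≡ y → x ≤ y
  ≤-reflexive refl = ≤-refl

  ≤-trans : ∀ {x y z} → x ≤ y → y ≤ z → x ≤ z
  ≤-trans {x} (u , refl) (v , refl) = u + v , sym (+-assoc x u v)

  <⇒≤ : ∀ {x y} → x < y → x ≤ y
  <⇒≤ (z , e) = S# z , e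

  <-≤-trans : ∀ {x y z} → x < y → y ≤ z → x < z
  <-≤-trans {x} p (v , refl) with <-elim p
  ... | u , refl = <-intro (u + v) (solve 3 (λ x u v → x :+ (u :+ v) :+ con 1 := x :+ u :+ con 1 :+ v) refl x u v)

  ≤-<-trans : ∀ {x y z} → x ≤ y → y < z → x < z
  ≤-<-trans {x} (u , refl) q with <-elim q
  ... | v , refl = <-intro (u + v) (solve 3 (λ x u v → x :+ (u :+ v) :+ con 1 := x :+ u :+ v :+ con 1) refl x u v)

  <-trans : ∀ {x y z} → x < y → y < z → x < z
  <-trans p q = <-≤-trans p (<⇒≤ q)

  <-irrefl : ∀ x → ¬ x < x
  <-irrefl x (z , e) = S≢0 z (+-cancelˡ x _ _ (trans e (sym (+-zero x))))

  <-asym : ∀ {x y} → x < y → ¬ y < x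
  <-asym p q = <-irrefl _ (<-trans p q)

  <⇒≢ : ∀ {x y} → x < y → x ≢ y
  <⇒≢ p refl = <-irrefl _ p

  <⇒≱ : ∀ {x y} → x < y → ¬ y ≤ x
  <⇒≱ p q = <-irrefl _ (<-≤-trans p q)

  0≤ : ∀ x → 0# ≤ x
  0≤ x = x , +-zeroˡ x

  0<S : ∀ x → 0# < S# x
  0<S x = x , +-zeroˡ _

  ≮0 : ∀ x → ¬ x < 0#
  ≮0 x (z , e) = S≢0 z (m+n≡0⇒n≡0 x _ e)

  x<Sx : ∀ x → x < S# x
  x<Sx x = 0# , sym (S≡ x)

  <⇒S≤ : ∀ {x y} → x < y → S# x ≤ y
  <⇒S≤ {x} (z , e) = z , trans (trans (+-sucˡ x z) (sym (+-suc x z))) e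

  S≤⇒< : ∀ {x y} → S# x ≤ y → x < y
  S≤⇒< p = <-≤-trans (x<Sx _) p

  S-mono-< : ∀ {x y} → x < y → S# x < S# y
  S-mono-< {x} (z , e) = z , trans (+-sucˡ x _) (cong S# e)

  ≤⇒<⊎≡ : ∀ {x y} → x ≤ y → x < y ⊎ x ≡ y
  ≤⇒<⊎≡ {x} (z , e) with 0⊎S z
  ... | inj₁ refl = inj₂ (trans (sym (+-zero x)) e)
  ... | inj₂ (w , refl) = inj₁ (w , e)

  <S⇒≤ : ∀ {x y} → x < S# y → x ≤ y
  <S⇒≤ {x} (z , e) = z , S-inj _ _ (trans (sym (+-suc x z)) e)

  <S⇒<⊎≡ : ∀ {x y} → x < S# y → x < y ⊎ x ≡ y
  <S⇒<⊎≡ p = ≤⇒<⊎≡ (<S⇒≤ p)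

  ≤⊎> : ∀ x y → x ≤ y ⊎ y < x
  ≤⊎> x = induction (ex (atom (v₂ +' v₀ ≐ v₁)) ∨ (v₀ <' v₁)) (x ∷ []) base step
    where
    base : x ≤ 0# ⊎ 0# < x
    base with 0⊎S x
    ... | inj₁ refl = inj₁ ≤-refl
    ... | inj₂ (z , refl) = inj₂ (0<S z)
    step : ∀ y → x ≤ y ⊎ y < x → x ≤ S# y ⊎ S# y < x
    step y (inj₁ p) = inj₁ (≤-trans p (<⇒≤ (x<Sx y)))
    step y (inj₂ q) with ≤⇒<⊎≡ (<⇒S≤ q)
    ... | inj₁ lt = inj₂ lt
    ... | inj₂ refl = inj₁ ≤-refl

  ≤-total : ∀ x y → x ≤ y ⊎ y ≤ x
  ≤-total x y = Sum.map₂ <⇒≤ (≤⊎> x y)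

  compare : ∀ x y → x < y ⊎ x ≡ y ⊎ y < x
  compare x y with ≤⊎> x y
  ... | inj₂ q = inj₂ (inj₂ q)
  ... | inj₁ p with ≤⇒<⊎≡ p
  ...   | inj₁ lt = inj₁ lt
  ...   | inj₂ e = inj₂ (inj₁ e)

  m≤m+n : ∀ x y → x ≤ x + y
  m≤m+n x y = y , refl

  m≤n+m : ∀ x y → x ≤ y + x
  m≤n+m x y = y , +-comm x y

  +-monoˡ-< : ∀ {x y} z → x < y → x + z < y + z
  +-monoˡ-< {x} z p with <-elim p
  ... | u , refl = <-intro u (solve 3 (λ x z u → x :+ z :+ u :+ con 1 := x :+ u :+ con 1 :+ z) refl x z u)

  +-mono-≤ : ∀ {x y u v} → x ≤ y → u ≤ v → x + u ≤ y + v
  +-mono-≤ {x} {u = u} (a , refl) (b , refl) =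
    a + b , solve 4 (λ x u a b → x :+ u :+ (a :+ b) := x :+ a :+ (u :+ b)) refl x u a b

  +-mono-<-≤ : ∀ {x y u v} → x < y → u ≤ v → x + u < y + v
  +-mono-<-≤ p q = <-≤-trans (+-monoˡ-< _ p) (+-mono-≤ ≤-refl q)

  ·-mono-≤ : ∀ {x y u v} → x ≤ y → u ≤ v → x · u ≤ y · v
  ·-mono-≤ {x} {u = u} (a , refl) (b , refl) =
    a · u + x · b + a · b ,
    solve 4 (λ x u a b → x :* u :+ (a :* u :+ x :* b :+ a :* b) := (x :+ a) :* (u :+ b)) refl x u a b

  m≤m·n : ∀ x {y} → 0# < y → x ≤ x · y
  m≤m·n x p = ≤-trans (≤-reflexive (sym (·-identityʳ x))) (·-mono-≤ ≤-refl (<⇒S≤ p))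

  0<⇒S : ∀ {x} → 0# < x → ∃[ y ] x ≡ S# y
  0<⇒S (z , e) = z , trans (sym e) (+-zeroˡ _)

  0<-· : ∀ {x y} → 0# < x → 0# < y → 0# < x · y
  0<-· p q = <-≤-trans p (m≤m·n _ q)

  abstract
    div-mod : ∀ d → 0# < d → ∀ x → ∃[ q ] ∃[ r ] (r < d × q · d + r ≡ x)
    div-mod d 0<d = induction (ex ex (v₀ <' v₃ ∧ atom (v₁ ·' v₃ +' v₀ ≐ v₂))) (d ∷ [])
      (0# , 0# , 0<d , trans (+-zero _) (·-zeroˡ d)) step
      where
      step : ∀ x → ∃[ q ] ∃[ r ] (r < d × q · d + r ≡ x) → ∃[ q ] ∃[ r ] (r < d × q · d + r ≡ S# x)
      step x (q , r , r<d , e) with ≤⇒<⊎≡ (<⇒S≤ r<d)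
      ... | inj₁ lt = q , S# r , lt , trans (+-suc _ r) (cong S# e)
      ... | inj₂ refl = S# q , 0# , 0<d ,
        trans (+-zero _) (trans (·-sucˡ q d) (trans (+-suc _ r) (cong S# e)))

  -- If `q'` were `q + z + 1`, cancelling `q · d` would exhibit `d` as a summand of `r`.
  quotient-≮ : ∀ {d q q' r r'} → r < d → q · d + r ≡ q' · d + r' → ¬ q < q'
  quotient-≮ {d} {q} {q'} {r} {r'} r<d e p with <-elim p
  ... | z , refl = <⇒≱ r<d (z · d + r' , +-cancelˡ (q · d) _ _ (trans
        (solve 4 (λ q d z r' → q :* d :+ (d :+ (z :* d :+ r')) := (q :+ z :+ con 1) :* d :+ r') refl q d z r')
        (sym e)))

  div-unique : ∀ {d q q' r r'} → r < d → r' < d → q · d + r ≡ q' · d + r' → q ≡ q' × r ≡ r'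
  div-unique {d} {q} {q'} p p' e with compare q q'
  ... | inj₁ lt = contradiction lt (quotient-≮ p e)
  ... | inj₂ (inj₂ gt) = contradiction gt (quotient-≮ p' (sym e))
  ... | inj₂ (inj₁ refl) = refl , +-cancelˡ (q · d) _ _ e

-- Gödel's β-function and the extension of coded sequences.

infix 8 _≤'_

_≤'_ : ∀ {n} → Term n → Term n → ArithFormula n
s ≤' t = ex (atom (wk s +' v₀ ≐ wk t))

module BetaFunction {ℓ} (M : ArithStructure ℓ) (isPA : IsPAModel M) where
  open Arithmetic M isPA

  modulus : C → C → C
  modulus b i = S# (S# i · b)

  β : C → C → C → C → Set ℓ
  β a b i v = v < modulus b i × ∃[ q ] q · modulus b i + v ≡ a

  β-unique : ∀ {a b i v w} → β a b i v → β a b i w → v ≡ w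
  β-unique (v< , _ , e) (w< , _ , e') = proj₂ (div-unique v< w< (trans e (sym e')))

  β-total : ∀ a b i → ∃[ v ] β a b i v
  β-total a b i with div-mod (modulus b i) (0<S _) a
  ... | q , r , r< , e = r , r< , q , e

  β-≤ : ∀ {a b i v} → β a b i v → v ≤ a
  β-≤ {v = v} (_ , q , e) = q · _ , trans (+-comm v _) e

  -- `P` is a unit modulo `d`. Multiples of `d` on both sides replace a signed one, since there is
  -- no subtraction.
  Invertible : C → C → Set ℓ
  Invertible d P = ∃[ u ] ∃[ v ] ∃[ w ] P · u + v · d ≡ 1# + w · d

  Invertible-· : ∀ {d P Q} → Invertible d P → Invertible d Q → Invertible d (P · Q)
  Invertible-· {d} {P} {Q} (u , v , w , e) (u' , v' , w' , e') =
    u · u' , P · u · v' + v · Q · u' + v · v' · d , w + w' + w · w' · d , (begin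
      P · Q · (u · u') + (P · u · v' + v · Q · u' + v · v' · d) · d
        ≡⟨ solve 7 (λ d P Q u v u' v' →
             P :* Q :* (u :* u') :+ (P :* u :* v' :+ v :* Q :* u' :+ v :* v' :* d) :* d
               := (P :* u :+ v :* d) :* (Q :* u' :+ v' :* d)) refl d P Q u v u' v' ⟩
      (P · u + v · d) · (Q · u' + v' · d)
        ≡⟨ cong₂ _·_ e e' ⟩
      (1# + w · d) · (1# + w' · d)
        ≡⟨ solve 3 (λ d w w' → (con 1 :+ w :* d) :* (con 1 :+ w' :* d)
               := con 1 :+ (w :+ w' :+ w :* w' :* d) :* d) refl d w w' ⟩
      1# + (w + w' + w · w' · d) · d ∎)
    where open ≡-Reasoning

  modulus≡ : ∀ b i → modulus b i ≡ 1# + (1# + i) · b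
  modulus≡ b i = trans (S≡ _) (trans (+-comm _ _) (cong (λ u → 1# + u · b) (trans (S≡ i) (+-comm i 1#))))

  -- With X = 1 + (j+1)(i+1)e one has (j+1)² e dᵢ + 1 = X dⱼ; multiplying by
  -- (j+1) b = dⱼ - 1 turns the inverse -(j+1)² e into a nonnegative one.
  modulus-invertible : ∀ i k e → Invertible (modulus (k · e) (i + k)) (modulus (k · e) i)
  modulus-invertible i k e rewrite modulus≡ (k · e) i | modulus≡ (k · e) (i + k) =
    s · s · s · e · b , 1# , s · b · (1# + s · (1# + i) · e) ,
    solve 3 (λ i k e →
      let b = k :* e
          s = con 1 :+ (i :+ k)
          dᵢ = con 1 :+ (con 1 :+ i) :* b
          dⱼ = con 1 :+ s :* b
      in dᵢ :* (s :* s :* s :* e :* b) :+ con 1 :* dⱼ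
           := con 1 :+ s :* b :* (con 1 :+ s :* (con 1 :+ i) :* e) :* dⱼ) refl i k e
    where
    b = k · e
    s = 1# + (i + k)

  -- Divide `x` by `d`. The remainder found and `r` are both remainders of `x + u · d`, hence equal.
  congruent⇒remainder : ∀ {d x r} u v → 0# < d → r < d → x + u · d ≡ r + v · d → ∃[ q ] q · d + r ≡ x
  congruent⇒remainder {d} {x} {r} u v 0<d r<d e with div-mod d 0<d x
  ... | q , r' , r'<d , refl with div-unique {d} {q + u} {v} r'<d r<d
          (trans (solve 4 (λ q u d r' → (q :+ u) :* d :+ r' := q :* d :+ r' :+ u :* d) refl q u d r')
                 (trans e (+-comm r _)))
  ...   | _ , refl = q , refl

  -- Modulo d = 1 + (i+1) b, the number (i+1) b is -1, so w + a (i+1) b is w - a.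
  crt-step : ∀ {b i P w} a → Invertible (modulus b i) P → w < modulus b i →
             ∃[ t ] β (a + P · t) b i w
  crt-step {b} {i} {P} {w} a (u , v , x , e) w<d = u · y , w<d ,
      congruent⇒remainder (v · y) (a + x · y) (0<S _) w<d (begin
        a + P · (u · y) + v · y · d
          ≡⟨ solve 6 (λ a P u y v d → a :+ P :* (u :* y) :+ v :* y :* d
               := a :+ (P :* u :+ v :* d) :* y) refl a P u y v d ⟩
        a + (P · u + v · d) · y
          ≡⟨ cong (λ z → a + z · y) e ⟩
        a + (1# + x · d) · y
          ≡⟨ solve 5 (λ a x d w m → a :+ (con 1 :+ x :* d) :* (w :+ a :* m)
               := w :+ a :* (m :+ con 1) :+ x :* (w :+ a :* m) :* d) refl a x d w (S# i · b) ⟩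
        w + a · (S# i · b + 1#) + x · y · d
          ≡⟨ cong (λ z → w + a · z + x · y · d) (S≡ _) ⟨
        w + a · d + x · y · d
          ≡⟨ solve 5 (λ w a x y d → w :+ a :* d :+ x :* y :* d := w :+ (a :+ x :* y) :* d) refl w a x y d ⟩
        w + (a + x · y) · d ∎)
    where
    open ≡-Reasoning
    d = modulus b i
    y = w + a · (S# i · b)

  β-+-multiple : ∀ {a b i v P} t → ∃[ m ] modulus b i · m ≡ P → β a b i v → β (a + P · t) b i v
  β-+-multiple {b = b} {i} {v} t (m , refl) (v< , q , refl) = v< , q + m · t ,
    solve 5 (λ q m t d v → (q :+ m :* t) :* d :+ v := q :* d :+ v :+ d :* m :* t)
      refl q m t (modulus b i) v

  -- The role of the factorial in Gödel's construction: with such a `b` the moduli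
  -- `1 + (i + 1) · b`, `i ≤ n`, are pairwise coprime.
  common-multiple : ∀ n → ∃[ b ] (0# < b × (∀ k → k < n → ∃[ m ] S# k · m ≡ b))
  common-multiple = induction
    (ex (O <' v₀ ∧ all (v₀ <' v₂ ⇒ ex (atom (S v₁ ·' v₀ ≐ v₂))))) []
    (1# , 0<S _ , λ k p → contradiction p (≮0 k)) step
    where
    step : ∀ n → ∃[ b ] (0# < b × (∀ k → k < n → ∃[ m ] S# k · m ≡ b)) →
           ∃[ b ] (0# < b × (∀ k → k < S# n → ∃[ m ] S# k · m ≡ b))
    step n (b , 0<b , h) = b · S# n , 0<-· 0<b (0<S n) , f
      where
      f : ∀ k → k < S# n → ∃[ m ] S# k · m ≡ b · S# n
      f k p with <S⇒<⊎≡ p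
      ... | inj₂ refl = b , ·-comm _ b
      ... | inj₁ lt with h k lt
      ...   | m , refl = m · S# n , sym (·-assoc _ m _)

  -- No recursion is available yet to define the product of the first `k` moduli, so the induction
  -- carries just the two properties of it that are used.
  product-of-moduli : ∀ b n → (∀ k → k < n → ∃[ m ] S# k · m ≡ b) → ∀ k →
    ∃[ P ] ((∀ i → i < k → ∃[ m ] modulus b i · m ≡ P) ×
            (∀ j → k ≤ j → j ≤ n → Invertible (modulus b j) P))
  product-of-moduli b n h = induction
    (ex (all (v₀ <' v₂ ⇒ ex (atom (S (S v₁ ·' v₄) ·' v₀ ≐ v₂))) ∧ all (v₂ ≤' v₀ ⇒ v₀ ≤' v₄ ⇒
          ex ex ex (atom (v₄ ·' v₂ +' v₁ ·' S (S v₃ ·' v₆) ≐ S O +' v₀ ·' S (S v₃ ·' v₆))))))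
    (b ∷ n ∷ [])
    (1# , (λ i p → contradiction p (≮0 i)) ,
      λ j _ _ → 1# , 0# , 0# , cong (_+ 0# · modulus b j) (·-identityˡ 1#))
    step
    where
    Product : C → Set ℓ
    Product k = ∃[ P ] ((∀ i → i < k → ∃[ m ] modulus b i · m ≡ P) ×
                        (∀ j → k ≤ j → j ≤ n → Invertible (modulus b j) P))
    step : ∀ k → Product k → Product (S# k)
    step k (P , divides , invertible) = P · modulus b k , divides' , invertible'
      where
      divides' : ∀ i → i < S# k → ∃[ m ] modulus b i · m ≡ P · modulus b k
      divides' i p with <S⇒<⊎≡ p
      ... | inj₂ refl = P , ·-comm _ P
      ... | inj₁ lt with divides i lt
      ...   | m , refl = m · modulus b k , sym (·-assoc _ m _)
      invertible' : ∀ j → S# k ≤ j → j ≤ n → Invertible (modulus b j) (P · modulus b k)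
      invertible' j k<j j≤n with S≤⇒< k<j
      -- The difference of `j` and `k` is `S# z`, which is at most `n` and therefore divides `b`.
      ... | z , refl with h z (<-≤-trans (<-≤-trans (x<Sx z) (m≤n+m (S# z) k)) j≤n)
      ...   | m , refl = Invertible-· (invertible j (<⇒≤ (S≤⇒< k<j)) j≤n) (modulus-invertible k (S# z) m)

  module Recoding (a b n w b₀ : C) (0<b₀ : 0# < b₀)
                  (h₀ : ∀ k → k < n → ∃[ m ] S# k · m ≡ b₀) where
    -- The values coded by `a` are at most `a`, so this factor lifts every modulus above them and
    -- above `w`.
    s = S# (a + w)
    b' = b₀ · s

    h : ∀ k → k < n → ∃[ m ] S# k · m ≡ b'
    h k p with h₀ k p
    ... | m , refl = m · s , sym (·-assoc _ m s)

    fits : ∀ {v} i → v ≤ a + w → v < modulus b' i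
    fits i p = ≤-<-trans p (<-≤-trans (x<Sx (a + w)) (≤-trans (≤-trans (m≤m·n s 0<b₀) (≤-reflexive (·-comm s b₀)))
      (≤-trans (≤-trans (m≤m·n b' (0<S i)) (≤-reflexive (·-comm b' _))) (<⇒≤ (x<Sx _)))))

    -- Adding a multiple of `P` does not disturb the remainders modulo the earlier moduli, all of
    -- which divide `P`.
    append : ∀ {k w a₀ P} → (∀ j → j < k → ∀ v → β a b j v → β a₀ b' j v) →
      (∀ j → j < k → ∃[ m ] modulus b' j · m ≡ P) →
      ∃[ t ] β (a₀ + P · t) b' k w →
      ∃[ a' ] ((∀ j → j < k → ∀ v → β a b j v → β a' b' j v) × β a' b' k w)
    append agrees divides (t , βₖ) =
      _ , (λ j lt v βj → β-+-multiple t (divides j lt) (agrees j lt v βj)) , βₖ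

    recode-step : ∀ k → k < n → ∃[ a' ] (∀ j → j < k → ∀ v → β a b j v → β a' b' j v) →
            ∃[ P ] ((∀ i → i < k → ∃[ m ] modulus b' i · m ≡ P) ×
                    (∀ j → k ≤ j → j ≤ n → Invertible (modulus b' j) P)) →
            ∃[ v ] β a b k v →
            ∃[ a' ] (∀ j → j < S# k → ∀ v → β a b j v → β a' b' j v)
    recode-step k k<n (a₀ , agrees) (P , divides , invertible) (vₖ , βₖ) =
      proj₁ next , λ j p v βj → agrees' p βj (<S⇒<⊎≡ p)
      where
      next = append agrees divides (crt-step a₀ (invertible k ≤-refl (<⇒≤ k<n)) (fits k (≤-trans (β-≤ βₖ) (m≤m+n a w))))
      agrees' : ∀ {j v} → j < S# k → β a b j v → j < k ⊎ j ≡ k → β (proj₁ next) b' j v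
      agrees' p βj (inj₁ lt) = proj₁ (proj₂ next) _ lt _ βj
      agrees' p βj (inj₂ refl) = subst (β (proj₁ next) b' k) (β-unique βₖ βj) (proj₂ (proj₂ next))

    -- The moduli given by `b` need not be coprime, so `a` cannot be corrected directly; its values
    -- are first copied one by one to the base `b'`.
    recode : ∀ k → k ≤ n → ∃[ a' ] (∀ j → j < k → ∀ v → β a b j v → β a' b' j v)
    recode = induction
      (v₀ ≤' v₄ ⇒ ex (all (v₀ <' v₂ ⇒ all (Beta v₄ v₅ v₁ v₀ ⇒ Beta v₂ v₆ v₁ v₀))))
      (a ∷ b ∷ b' ∷ n ∷ [])
      (λ _ → 0# , λ j p → contradiction p (≮0 j))
      step
      where
      step : ∀ k → (k ≤ n → ∃[ a' ] (∀ j → j < k → ∀ v → β a b j v → β a' b' j v)) →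
             S# k ≤ n → ∃[ a' ] (∀ j → j < S# k → ∀ v → β a b j v → β a' b' j v)
      step k ih k<n = recode-step k (S≤⇒< k<n) (ih (<⇒≤ (S≤⇒< k<n))) (product-of-moduli b' n h k) (β-total a b k)

    extension : ∃[ a' ] ((∀ j → j < n → ∀ v → β a b j v → β a' b' j v) × β a' b' n w)
    extension =
      let a₀ , agrees = recode n ≤-refl
          P , divides , invertible = product-of-moduli b' n h n
      in append agrees divides (crt-step a₀ (invertible n ≤-refl ≤-refl) (fits n (m≤n+m w a)))

  -- The source of all recursion inside `M`: a coded sequence can always be continued by a
  -- prescribed value.
  β-extend : ∀ a b n w → ∃[ a' ] ∃[ b' ] ((∀ j → j < n → ∀ v → β a b j v → β a' b' j v) × β a' b' n w)
  β-extend a b n w =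
    let b₀ , 0<b₀ , h = common-multiple n
        a' , ext = Recoding.extension a b n w b₀ 0<b₀ h
    in a' , Recoding.b' a b n w b₀ 0<b₀ h , ext

  -- `Step` is any relation of the metatheory; an induction about `Seq` has to write out a formula
  -- for its own `Step`.
  Seq : (C → C → Set ℓ) → C → C → C → C → Set ℓ
  Seq Step x a b n = β a b 0# x × (∀ i → i < n → ∃[ v ] ∃[ w ] (β a b i v × β a b (S# i) w × Step v w))

  Seq-append : ∀ {Step : C → C → Set ℓ} {x a b n v w} → Seq Step x a b n → β a b n v → Step v w →
               ∃[ a' ] ∃[ b' ] ((∀ j → j < S# n → ∀ v → β a b j v → β a' b' j v) × β a' b' (S# n) w) →
               ∃[ a' ] ∃[ b' ] Seq Step x a' b' (S# n)
  Seq-append {Step} {x} {a} {b} {n} {v} {w} (β₀ , steps) βₙ s (a' , b' , agrees , βSn) =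
    a' , b' , agrees 0# (0<S n) x β₀ , λ i p → steps' i p (<S⇒<⊎≡ p)
    where
    steps' : ∀ i → i < S# n → i < n ⊎ i ≡ n → ∃[ v ] ∃[ w ] (β a' b' i v × β a' b' (S# i) w × Step v w)
    steps' i p (inj₂ refl) = v , w , agrees n p v βₙ , βSn , s
    steps' i p (inj₁ lt) =
      let y , z , βi , βSi , s' = steps i lt
      in y , z , agrees i p y βi , agrees (S# i) (S-mono-< lt) z βSi , s'

  Seq-extend : ∀ {Step : C → C → Set ℓ} {x a b n} → (∀ v → ∃[ w ] Step v w) →
               Seq Step x a b n → ∃[ a' ] ∃[ b' ] Seq Step x a' b' (S# n)
  Seq-extend {a = a} {b} {n} total seq =
    let v , βₙ = β-total a b n
        w , s = total v
    in Seq-append seq βₙ s (β-extend a b (S# n) w)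

-- Powers of two and binary digits.

module Binary {ℓ} (M : ArithStructure ℓ) (isPA : IsPAModel M) where
  open Arithmetic M isPA
  open BetaFunction M isPA

  IsPow2 : C → C → Set ℓ
  IsPow2 i p = Sat (Pow2 v₀ v₁) (i ∷ p ∷ [])

  IsBit : C → C → Set ℓ
  IsBit i m = Sat (Bit v₀ v₁) (i ∷ m ∷ [])

  Doubling : C → C → C → Set ℓ
  Doubling a b n = Seq (λ v w → w ≡ v + v) 1# a b n

  doubling : ∀ n → ∃[ a ] ∃[ b ] Doubling a b n
  doubling = induction
    (ex ex (Beta v₁ v₀ O (S O) ∧ all (v₀ <' v₃ ⇒
      ex ex (Beta v₄ v₃ v₂ v₁ ∧ Beta v₄ v₃ (S v₂) v₀ ∧ atom (v₀ ≐ v₁ +' v₁))))) []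
    -- At length 0 there is nothing to preserve, so extending an arbitrary pair yields the initial
    -- value.
    (let a , b , _ , β₀ = β-extend 0# 0# 0# 1# in a , b , β₀ , λ i p → contradiction p (≮0 i))
    λ n (a , b , d) → Seq-extend (λ v → v + v , refl) d

  pow2-total : ∀ i → ∃[ p ] IsPow2 i p
  pow2-total i =
    let a , b , β₀ , steps = doubling i
        p , βᵢ = β-total a b i
    in p , a , b , β₀ , (λ j j<i → step (steps j j<i)) , βᵢ
    where
    step : ∀ {a b j} → ∃[ v ] ∃[ w ] (β a b j v × β a b (S# j) w × w ≡ v + v) →
           ∃[ v ] (β a b j v × β a b (S# j) (v + v))
    step (v , _ , βⱼ , βSⱼ , refl) = v , βⱼ , βSⱼ

  -- The coding pairs may differ, so the two sequences are compared position by position.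
  pow2-unique : ∀ {i p p'} → IsPow2 i p → IsPow2 i p' → p ≡ p'
  pow2-unique {i} {p} {p'} (a , b , β₀ , steps , βᵢ) (a' , b' , β₀' , steps' , βᵢ') =
    let v , βᵥ , βᵥ' = agree i ≤-refl
    in trans (β-unique βᵢ βᵥ) (β-unique βᵥ' βᵢ')
    where
    Common : C → Set ℓ
    Common j = ∃[ v ] (β a b j v × β a' b' j v)

    next : ∀ {j} → Common j → ∃[ v ] (β a b j v × β a b (S# j) (v + v)) →
           ∃[ v ] (β a' b' j v × β a' b' (S# j) (v + v)) → Common (S# j)
    next {j} (v , βᵥ , βᵥ') (w , βw , βSw) (w' , βw' , βSw') = w + w , βSw ,
      subst (λ u → β a' b' (S# j) (u + u)) (trans (β-unique βw' βᵥ') (β-unique βᵥ βw)) βSw'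

    agree : ∀ j → j ≤ i → Common j
    agree = induction (v₀ ≤' v₅ ⇒ ex (Beta v₂ v₃ v₁ v₀ ∧ Beta v₄ v₅ v₁ v₀)) (a ∷ b ∷ a' ∷ b' ∷ i ∷ [])
      (λ _ → 1# , β₀ , β₀')
      λ j ih j<i → next (ih (<⇒≤ (S≤⇒< j<i))) (steps j (S≤⇒< j<i)) (steps' j (S≤⇒< j<i))

  abstract
    -- Not a term of the language: inductions on the exponent speak of `Pow2`, and `isPow2⇒≡`
    -- translates back.
    pow : C → C
    pow i = proj₁ (pow2-total i)

    pow-isPow2 : ∀ i → IsPow2 i (pow i)
    pow-isPow2 i = proj₂ (pow2-total i)

  isPow2⇒≡ : ∀ {i p} → IsPow2 i p → p ≡ pow i
  isPow2⇒≡ h = pow2-unique h (pow-isPow2 _)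

  pow-zero : pow 0# ≡ 1#
  pow-zero = let a , b , β₀ , _ , β₀' = pow-isPow2 0# in β-unique β₀' β₀

  pow-suc : ∀ i → pow (S# i) ≡ pow i + pow i
  pow-suc i = from (pow-isPow2 (S# i))
    where
    from : ∀ {p} → IsPow2 (S# i) p → p ≡ pow i + pow i
    from (a , b , β₀ , steps , βᵢ) =
      let v , βᵥ , βSᵥ = steps i (x<Sx i)
          -- The same pair, read only up to `i`, witnesses that `v` is the power for `i`.
          v≡ = isPow2⇒≡ (a , b , β₀ , (λ j p → steps j (<-trans p (x<Sx i))) , βᵥ)
      in trans (β-unique βᵢ βSᵥ) (cong₂ _+_ v≡ v≡)

  i<pow : ∀ i → i < pow i
  i<pow i =
    let p , h , i<p = induction (ex (Pow2 v₁ v₀ ∧ v₁ <' v₀)) []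
          (pow 0# , pow-isPow2 0# , subst (0# <_) (sym pow-zero) (0<S 0#))
          (λ i (p , h , i<p) → pow (S# i) , pow-isPow2 (S# i) , subst (S# i <_)
            (trans (cong₂ _+_ (isPow2⇒≡ h) (isPow2⇒≡ h)) (sym (pow-suc i)))
            (subst (_< p + p) (sym (S≡ i)) (+-mono-<-≤ i<p (<⇒S≤ (≤-<-trans (0≤ i) i<p))))) i
    in subst (i <_) (isPow2⇒≡ h) i<p

  0<pow : ∀ i → 0# < pow i
  0<pow i = ≤-<-trans (0≤ i) (i<pow i)

  pow-+ : ∀ i k → pow (i + k) ≡ pow i · pow k
  pow-+ i k =
    let p , q , hp , hq , e = induction
          (ex ex (Pow2 (v₃ +' v₂) v₁ ∧ Pow2 v₂ v₀ ∧ atom (v₁ ≐ v₄ ·' v₀))) (i ∷ pow i ∷ [])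
          (pow (i + 0#) , pow 0# , pow-isPow2 _ , pow-isPow2 _ ,
            trans (cong pow (+-zero i)) (sym (trans (cong (pow i ·_) pow-zero) (·-identityʳ _))))
          (λ k (p , q , hp , hq , e) → pow (i + S# k) , pow (S# k) , pow-isPow2 _ , pow-isPow2 _ ,
            step k (trans (sym (isPow2⇒≡ hp)) (trans e (cong (pow i ·_) (isPow2⇒≡ hq))))) k
    in trans (sym (isPow2⇒≡ hp)) (trans e (cong (pow i ·_) (isPow2⇒≡ hq)))
    where
    step : ∀ k → pow (i + k) ≡ pow i · pow k → pow (i + S# k) ≡ pow i · pow (S# k)
    step k e = begin
      pow (i + S# k)                    ≡⟨ cong pow (+-suc i k) ⟩
      pow (S# (i + k))                  ≡⟨ pow-suc (i + k) ⟩
      pow (i + k) + pow (i + k)         ≡⟨ cong₂ _+_ e e ⟩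
      pow i · pow k + pow i · pow k     ≡⟨ ·-distribˡ (pow i) _ _ ⟨
      pow i · (pow k + pow k)           ≡⟨ cong (pow i ·_) (pow-suc k) ⟨
      pow i · pow (S# k)                ∎
      where open ≡-Reasoning

  pow-mono-≤ : ∀ {i j} → i ≤ j → pow i ≤ pow j
  pow-mono-≤ {i} (z , refl) = ≤-trans (m≤m·n (pow i) (0<pow z)) (≤-reflexive (sym (pow-+ i z)))

  -- A positive form of the negation of `IsBit`: the quotient by `pow i` is even instead of odd.
  IsZeroBit : C → C → Set ℓ
  IsZeroBit i m = ∃[ q ] ∃[ r ] (r < pow i × m ≡ (q + q) · pow i + r)

  bit-intro : ∀ {i m} q r → r < pow i → m ≡ S# (q + q) · pow i + r → IsBit i m
  bit-intro {i} q r r< e = pow i , q , r , pow-isPow2 i , r< , e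

  bit-elim : ∀ {i m} → IsBit i m → ∃[ q ] ∃[ r ] (r < pow i × m ≡ S# (q + q) · pow i + r)
  bit-elim (p , q , r , h , r< , e) =
    q , r , subst (r <_) (isPow2⇒≡ h) r< , trans e (cong (λ p → S# (q + q) · p + r) (isPow2⇒≡ h))

  parity : ∀ x → ∃[ q ] (x ≡ q + q ⊎ x ≡ S# (q + q))
  parity = induction (ex (atom (v₁ ≐ v₀ +' v₀) ∨ atom (v₁ ≐ S (v₀ +' v₀)))) []
    (0# , inj₁ (sym (+-zero 0#))) step
    where
    step : ∀ x → ∃[ q ] (x ≡ q + q ⊎ x ≡ S# (q + q)) → ∃[ q ] (S# x ≡ q + q ⊎ S# x ≡ S# (q + q))
    step _ (q , inj₁ refl) = q , inj₂ refl
    step _ (q , inj₂ refl) = S# q , inj₁ (sym (trans (+-suc _ q) (cong S# (+-sucˡ q q))))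

  -- Division by 2 leaves remainder 1 on the left and 0 on the right.
  odd≢even : ∀ q q' → S# (q + q) ≢ q' + q'
  odd≢even q q' e = S≢0 0# (proj₂ (div-unique {1# + 1#} {q} {q'} (S-lt) (≤-<-trans (0≤ _) S-lt)
    (trans (solve 1 (λ q → q :* (con 1 :+ con 1) :+ con 1 := q :+ q :+ con 1) refl q)
      (trans (sym (S≡ _)) (trans e (solve 1 (λ q → q :+ q := q :* (con 1 :+ con 1) :+ con 0) refl q'))))))
    where
    S-lt : 1# < 1# + 1#
    S-lt = <-intro 0# (cong (_+ 1#) (+-zero 1#))

  bit? : ∀ i m → IsBit i m ⊎ IsZeroBit i m
  bit? i m =
    let Q , r , r< , e = div-mod (pow i) (0<pow i) m
        q , h = parity Q
    in from Q q r r< e h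
    where
    from : ∀ Q q r → r < pow i → Q · pow i + r ≡ m → Q ≡ q + q ⊎ Q ≡ S# (q + q) → IsBit i m ⊎ IsZeroBit i m
    from _ q r r< e (inj₁ refl) = inj₂ (q , r , r< , sym e)
    from _ q r r< e (inj₂ refl) = inj₁ (bit-intro q r r< (sym e))

  zeroBit⇒¬bit : ∀ {i m} → IsZeroBit i m → ¬ IsBit i m
  zeroBit⇒¬bit (q' , r' , r'< , e') b =
    let q , r , r< , e = bit-elim b
    in odd≢even q q' (proj₁ (div-unique r< r'< (trans (sym e) e')))

  -- A bit at `i` forces `pow i ≤ m`, and `i < pow i`.
  bit⇒< : ∀ {i m} → IsBit i m → i < m
  bit⇒< {i} b =
    let q , r , r< , e = bit-elim b
    in <-≤-trans (i<pow i) (≤-trans (≤-trans (m≤m·n (pow i) (0<S (q + q))) (≤-reflexive (·-comm _ _)))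
         (≤-trans (m≤m+n _ r) (≤-reflexive (sym e))))

  <pow⇒zeroBit : ∀ {i m} → m < pow i → IsZeroBit i m
  <pow⇒zeroBit {i} {m} m< = 0# , m , m< , sym (trans (cong (λ u → u · pow i + m) (+-zero 0#))
    (trans (cong (_+ m) (·-zeroˡ _)) (+-zeroˡ m)))

  top-bit : ∀ {B m} → m < pow B → IsBit B (m + pow B)
  top-bit {B} {m} m< = bit-intro 0# m m< (trans (+-comm m _) (cong (_+ m)
    (sym (trans (cong (λ u → S# u · pow B) (+-zero 0#)) (·-identityˡ _)))))

  -- Adding an even multiple of `pow i` keeps the parity of the quotient, so adding `pow B` does not
  -- affect the bits below `B`.
  pow-split : ∀ {i B} → i < B → ∃[ t ] pow B ≡ (t + t) · pow i
  pow-split {i} (z , refl) = pow z , trans (pow-+ i (S# z)) (trans (·-comm _ _) (cong (_· pow i) (pow-suc z)))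

  bit-+pow : ∀ {i B m} → i < B → IsBit i m → IsBit i (m + pow B)
  bit-+pow {i} {B} {m} i<B b =
    let q , r , r< , e = bit-elim b
        t , e' = pow-split i<B
    in bit-intro (q + t) r r< (trans (cong₂ _+_ (trans e (cong (λ u → u · pow i + r) (S≡ _))) e')
         (trans (solve 4 (λ q r t p → (q :+ q :+ con 1) :* p :+ r :+ (t :+ t) :* p
             := (q :+ t :+ (q :+ t) :+ con 1) :* p :+ r) refl q r t (pow i))
           (cong (λ u → u · pow i + r) (sym (S≡ _)))))

  zeroBit-+pow : ∀ {i B m} → i < B → IsZeroBit i m → IsZeroBit i (m + pow B)
  zeroBit-+pow {i} {B} {m} i<B (q , r , r< , e) =
    let t , e' = pow-split i<B
    in q + t , r , r< , trans (cong₂ _+_ e e')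
         (solve 4 (λ q r t p → (q :+ q) :* p :+ r :+ (t :+ t) :* p
             := (q :+ t :+ (q :+ t)) :* p :+ r) refl q r t (pow i))

  bit-+pow⁻ : ∀ {i B m} → i < B → IsBit i (m + pow B) → IsBit i m
  bit-+pow⁻ {i} {B} {m} i<B b = from (bit? i m)
    where
    from : IsBit i m ⊎ IsZeroBit i m → IsBit i m
    from (inj₁ b') = b'
    from (inj₂ z) = contradiction b (zeroBit⇒¬bit (zeroBit-+pow i<B z))

  m+powB<powSB : ∀ {m B} → m < pow B → m + pow B < pow (S# B)
  m+powB<powSB {m} {B} m< = subst (m + pow B <_) (sym (pow-suc B)) (+-monoˡ-< (pow B) m<)

-- Towers of powers of two and the codes of vertices.

infix 1 _⟷_

_⟷_ : ∀ {a b} → Set a → Set b → Set _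
P ⟷ Q = (P → Q) × (Q → P)

module Codes {ℓ} (em : ExcludedMiddle ℓ) (M : ArithStructure ℓ) (isPA : IsPAModel M) where
  open Arithmetic M isPA
  open BetaFunction M isPA
  open Binary M isPA

  IsTower : C → C → C → C → Set ℓ
  IsTower K a b n = Seq IsPow2 K a b n

  tower : ∀ K n → ∃[ a ] ∃[ b ] IsTower K a b n
  tower K = induction
    (ex ex (Beta v₁ v₀ O v₃ ∧ all (v₀ <' v₃ ⇒
      ex ex (Beta v₄ v₃ v₂ v₁ ∧ Beta v₄ v₃ (S v₂) v₀ ∧ Pow2 v₁ v₀)))) (K ∷ [])
    (let a , b , _ , β₀ = β-extend 0# 0# 0# K in a , b , β₀ , λ i p → contradiction p (≮0 i))
    λ n (a , b , t) → Seq-extend pow2-total t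

  -- What is used of the tower `T 0 = K`, `T (i+1) = 2^(T i)`. The second clause covers all `i < j`,
  -- since levels along an edge differ by more than one.
  TowerFunction : C → C → (C → C) → Set ℓ
  TowerFunction K n T = (∀ {i} → i ≤ n → K ≤ T i) × (∀ {i j} → i < j → j ≤ n → pow (T i) ≤ T j)

  abstract
    tower-function : ∀ K n → ∃[ T ] TowerFunction K n T
    tower-function K n = from (tower K n)
      where
      from : ∃[ a ] ∃[ b ] IsTower K a b n →
             ∃[ T ] TowerFunction K n T
      from (a , b , β₀ , steps) = T , (λ {i} p → K≤T p (≤⇒<⊎≡ (0≤ i))) , grows
        where
        T : C → C
        T i = proj₁ (β-total a b i)

        T-β : ∀ {i v} → β a b i v → T i ≡ v
        T-β {i} h = β-unique (proj₂ (β-total a b i)) h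

        T-suc : ∀ i → i < n → T (S# i) ≡ pow (T i)
        T-suc i p =
          let v , w , βᵥ , βw , h = steps i p
          in trans (T-β βw) (trans (isPow2⇒≡ h) (cong pow (sym (T-β βᵥ))))

        -- `T j` is not a term, so the induction on `j` names it by its β-value; `pow (T i)` is a
        -- parameter.
        Grown : C → C → Set ℓ
        Grown i j = ∃[ v ] (β a b j v × pow (T i) ≤ v)

        grown : ∀ i j → i < j → j ≤ n → Grown i j
        grown i = induction (v₁ <' v₀ ⇒ v₀ ≤' v₅ ⇒ ex (Beta v₃ v₄ v₁ v₀ ∧ v₅ ≤' v₀))
          (i ∷ a ∷ b ∷ pow (T i) ∷ n ∷ [])
          (λ p → contradiction p (≮0 i))
          λ j ih i<Sj j<n → step j (S≤⇒< j<n) (λ p → ih p (<⇒≤ (S≤⇒< j<n))) (<S⇒<⊎≡ i<Sj)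
          where
          step : ∀ j → j < n → (i < j → Grown i j) → i < j ⊎ i ≡ j → Grown i (S# j)
          step j j<n ih p = T (S# j) , proj₂ (β-total a b (S# j)) , subst (pow (T i) ≤_) (sym (T-suc j j<n)) (bound p)
            where
            bound : i < j ⊎ i ≡ j → pow (T i) ≤ pow (T j)
            bound (inj₂ refl) = ≤-refl
            bound (inj₁ lt) =
              let v , βᵥ , le = ih lt
              in ≤-trans le (≤-trans (≤-reflexive (sym (T-β βᵥ))) (<⇒≤ (i<pow (T j))))

        grows : ∀ {i j} → i < j → j ≤ n → pow (T i) ≤ T j
        grows {i} {j} p q =
          let v , βᵥ , le = grown i j p q
          in ≤-trans le (≤-reflexive (sym (T-β βᵥ)))

        K≤T : ∀ {i} → i ≤ n → 0# < i ⊎ 0# ≡ i → K ≤ T i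
        K≤T p (inj₂ refl) = ≤-reflexive (sym (T-β β₀))
        K≤T p (inj₁ lt) = ≤-trans (≤-reflexive (sym (T-β β₀))) (≤-trans (<⇒≤ (i<pow (T 0#))) (grows lt p))

  -- The Rado graph, with the bits of the larger number listing its smaller neighbours.
  Rado : C → C → Set ℓ
  Rado s r = IsBit s r ⊎ IsBit r s

  module _ (K : C) where

    Neighbour : C → C → Set ℓ
    Neighbour s i = ∃[ q ] ∃[ r ] (r < K × i ≡ q · pow K + (K + r) × Rado s r)

    Labelled : C → C → Set ℓ
    Labelled s z = ∃[ q ] z ≡ q · pow K + (K + s)

    -- A code is at least K, by its label K + s, so membership between codes never
    -- involves bits below K; these carry the label as the residue modulo 2ᴷ.
    Coded : C → C → C → Set ℓ
    Coded B s z = z < pow B × Labelled s z × (∀ i → K ≤ i → i < B → IsBit i z ⟷ Neighbour s i)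

    -- With `K = k + 1`, both `K` and `s` are at most `pow k`. Hence the residue modulo `pow K`
    -- determines the label.
    K+s<pow : ∀ {s} → s < K → K + s < pow K
    K+s<pow s<K = from (0<⇒S (≤-<-trans (0≤ _) s<K)) s<K
      where
      from : ∀ {K s} → ∃[ k ] K ≡ S# k → s < K → K + s < pow K
      from {s = s} (k , refl) s<K = <-≤-trans (subst (_< S# k + S# k) (+-comm s _) (+-monoˡ-< (S# k) s<K))
        (≤-trans (+-mono-≤ (<⇒S≤ (i<pow k)) (<⇒S≤ (i<pow k))) (≤-reflexive (sym (pow-suc k))))

    pow-K-∣ : ∀ {B} → K ≤ B → ∃[ t ] pow B ≡ t · pow K
    pow-K-∣ (z , refl) = pow z , trans (pow-+ K z) (·-comm _ _)

    -- As `K ≤ B`, the number `pow B` is a multiple of `pow K`, so the label survives.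
    insert : ∀ {B s z} → K ≤ B → Coded B s z → Neighbour s B → Coded (S# B) s (z + pow B)
    insert {B} {s} {z} K≤B (z< , (q , e) , bits) nb =
      m+powB<powSB z< ,
      (let t , e' = pow-K-∣ K≤B in q + t , trans (cong₂ _+_ e e')
        (solve 4 (λ q t p l → q :* p :+ l :+ t :* p := (q :+ t) :* p :+ l) refl q t (pow K) (K + s))) ,
      λ i K≤i i< → bits' i K≤i (<S⇒<⊎≡ i<)
      where
      bits' : ∀ i → K ≤ i → i < B ⊎ i ≡ B → IsBit i (z + pow B) ⟷ Neighbour s i
      bits' i K≤i (inj₁ lt) = (λ b → proj₁ (bits i K≤i lt) (bit-+pow⁻ lt b)) ,
                              (λ n → bit-+pow lt (proj₂ (bits i K≤i lt) n))
      bits' i K≤i (inj₂ refl) = (λ _ → nb) , (λ _ → top-bit z<)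

    skip : ∀ {B s z} → Coded B s z → ¬ Neighbour s B → Coded (S# B) s z
    skip {B} {s} {z} (z< , lab , bits) ¬nb = <-≤-trans z< (pow-mono-≤ (<⇒≤ (x<Sx B))) , lab ,
      λ i K≤i i< → bits' i K≤i (<S⇒<⊎≡ i<)
      where
      bits' : ∀ i → K ≤ i → i < B ⊎ i ≡ B → IsBit i z ⟷ Neighbour s i
      bits' i K≤i (inj₁ lt) = bits i K≤i lt
      bits' i K≤i (inj₂ refl) = (λ b → contradiction b (zeroBit⇒¬bit (<pow⇒zeroBit z<))) ,
                                (λ n → contradiction n ¬nb)

    -- The bits are settled one position at a time, upwards from `K`. As `k` may be nonstandard,
    -- this is an induction in `M`, so adjacency must be a formula. The Rado graph provides one,
    -- whereas the given relation on the vertices need not be definable.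
    code : ∀ s → s < K → ∀ k → ∃[ z ] Coded (K + k) s z
    code s s<K k =
      let z , p , h , z< , rest = induction
            (ex ex (Pow2 (v₄ +' v₂) v₀ ∧ v₁ <' v₀ ∧ ex (atom (v₂ ≐ v₀ ·' v₆ +' (v₅ +' v₄))) ∧
              all (v₅ ≤' v₀ ⇒ v₀ <' v₅ +' v₃ ⇒
                ((Bit v₀ v₂ ⇒ nb) ∧ (nb ⇒ Bit v₀ v₂)))))
            (s ∷ K ∷ pow K ∷ [])
            -- No position is at least `K` and below `K`, so the bare label is a code.
            (K + s , relational (+-zero K) (K+s<pow s<K ,
              (0# , sym (trans (cong (_+ (K + s)) (·-zeroˡ _)) (+-zeroˡ _))) ,
              λ i K≤i i<K → contradiction K≤i (<⇒≱ i<K)))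
            (λ k (z , p , h , z< , rest) →
              let z' , coded = next k (subst (z <_) (isPow2⇒≡ h) z< , rest) em
              in z' , relational refl coded) k
      in z , subst (z <_) (isPow2⇒≡ h) z< , rest
      where
      nb : ∀ {n} → ArithFormula (suc (suc (suc (suc (suc (suc (suc n)))))))
      nb = ex ex (v₀ <' v₇ ∧ atom (v₂ ≐ v₁ ·' v₈ +' (v₇ +' v₀)) ∧ (Bit v₆ v₀ ∨ Bit v₀ v₆))

      Relational : C → C → Set ℓ
      Relational B z = ∃[ p ] (IsPow2 B p × z < p × Labelled s z × (∀ i → K ≤ i → i < B → IsBit i z ⟷ Neighbour s i))

      relational : ∀ {B B' z} → B' ≡ B → Coded B s z → Relational B' z
      relational refl (z< , rest) = pow _ , pow-isPow2 _ , z< , rest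

      next : ∀ k {z} → Coded (K + k) s z → Dec (Neighbour s (K + k)) → ∃[ z' ] Coded (K + S# k) s z'
      next k {z} h (yes n) = _ , subst (λ B → Coded B s (z + pow (K + k))) (sym (+-suc K k)) (insert (m≤m+n K k) h n)
      next k {z} h (no ¬n) = z , subst (λ B → Coded B s z) (sym (+-suc K k)) (skip h ¬n)

    abstract
      code-at : ∀ {B s} → K ≤ B → s < K → ∃[ z ] Coded B s z
      code-at (k , refl) s<K = code _ s<K k

    labels-agree : ∀ {s s' q q'} → s < K → s' < K → q · pow K + (K + s) ≡ q' · pow K + (K + s') → s ≡ s'
    labels-agree s< s'< e = +-cancelˡ K _ _ (proj₂ (div-unique (K+s<pow s<) (K+s<pow s'<) e))

    label-unique : ∀ {s s' z} → s < K → s' < K → Labelled s z → Labelled s' z → s ≡ s'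
    label-unique s< s'< (_ , e) (_ , e') = labels-agree s< s'< (trans (sym e) e')

    neighbour⇒rado : ∀ {s s' z} → s' < K → Labelled s' z → Neighbour s z → Rado s s'
    neighbour⇒rado {s} s'< (q , e) (q' , r , r< , e' , h) =
      subst (Rado s) (labels-agree r< s'< (trans (sym e') e)) h

    labelled-≥ : ∀ {s z} → Labelled s z → K ≤ z
    labelled-≥ {s} (q , refl) = ≤-trans (m≤m+n K s) (m≤n+m _ _)

    -- The position `z'` is at least `K` by its label and below `B` because `z < pow B`, so the bit
    -- condition of the code applies to it.
    bit⇒rado : ∀ {B s z s' z'} → s' < K → Coded B s z → Labelled s' z' → IsBit z' z → Rado s s'
    bit⇒rado {B} {z = z} {z' = z'} s'< (z< , _ , bits) lab b =
      neighbour⇒rado s'< lab (proj₁ (bits z' (labelled-≥ lab) (below (≤⊎> B z'))) b)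
      where
      below : B ≤ z' ⊎ z' < B → z' < B
      below (inj₂ lt) = lt
      below (inj₁ le) = contradiction b (zeroBit⇒¬bit (<pow⇒zeroBit (<-≤-trans z< (pow-mono-≤ le))))

    rado⇒bit : ∀ {B s z s' z'} → s' < K → Coded B s z → Labelled s' z' → z' < B → Rado s s' → IsBit z' z
    rado⇒bit s'< (_ , _ , bits) lab@(q , e) z'<B h = proj₂ (bits _ (labelled-≥ lab) z'<B) (q , _ , s'< , e , h)

-- Choosing an infinite sequence one term at a time.

module Sequential {a p} {A : Set a} (U : ℕ → A → Set p) (R : ℕ → ℕ → A → A → Set p) where

  -- A finite sequence is represented by a total function whose values below `n` alone are
  -- constrained.
  GoodBelow : ℕ → (ℕ → A) → Set p
  GoodBelow n f = (∀ {m} → m ℕ.< n → U m (f m)) × (∀ {m k} → m ℕ.< k → k ℕ.< n → R m k (f m) (f k))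

  module _ (a₀ : A) (choose : ∀ n f → GoodBelow n f → ∃[ z ] (U n z × (∀ {m} → m ℕ.< n → R m n (f m) z))) where

    update : (ℕ → A) → ℕ → A → ℕ → A
    update f n z m with m ℕ.<? n
    ... | yes _ = f m
    ... | no _ = z

    update-< : ∀ {f n z m} → m ℕ.< n → update f n z m ≡ f m
    update-< {n = n} {m = m} m<n with m ℕ.<? n
    ... | yes _ = refl
    ... | no m≮n = contradiction m<n m≮n

    update-≡ : ∀ {f} n {z} → update f n z n ≡ z
    update-≡ n with n ℕ.<? n
    ... | yes n<n = contradiction n<n (ℕ.<-irrefl refl)
    ... | no _ = refl

    extend : ∀ {n} f → GoodBelow n f → ℕ → A
    extend {n} f good = update f n (proj₁ (choose n f good))

    extend-good : ∀ {n} f (good : GoodBelow n f) → GoodBelow (suc n) (extend f good)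
    extend-good {n} f good = unary , binary
      where
      z = proj₁ (choose n f good)
      hz = proj₂ (choose n f good)

      unary : ∀ {m} → m ℕ.< suc n → U m (update f n z m)
      unary m<Sn with ℕ.m<1+n⇒m<n∨m≡n m<Sn
      ... | inj₁ m<n = subst (U _) (sym (update-< m<n)) (proj₁ good m<n)
      ... | inj₂ refl = subst (U n) (sym (update-≡ n)) (proj₁ hz)

      binary : ∀ {m k} → m ℕ.< k → k ℕ.< suc n → R m k (update f n z m) (update f n z k)
      binary m<k k<Sn with ℕ.m<1+n⇒m<n∨m≡n k<Sn
      ... | inj₁ k<n = subst₂ (R _ _) (sym (update-< (ℕ.<-trans m<k k<n))) (sym (update-< k<n)) (proj₂ good m<k k<n)
      ... | inj₂ refl = subst₂ (R _ n) (sym (update-< m<k)) (sym (update-≡ n)) (proj₂ hz m<k)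

    stage : ∀ n → ∃[ f ] GoodBelow n f
    stage zero = (λ _ → a₀) , (λ ()) , λ _ ()
    stage (suc n) = extend _ (proj₂ (stage n)) , extend-good _ (proj₂ (stage n))

    limit : ℕ → A
    limit n = proj₁ (stage (suc n)) n

    -- The passage from stage `n` to the next changes values only at `n` and above, so each value is
    -- final once chosen.
    stage-limit : ∀ {m n} → m ℕ.<′ n → proj₁ (stage n) m ≡ limit m
    stage-limit (ℕ.≤′-reflexive refl) = refl
    stage-limit {m} (ℕ.≤′-step {n} m<n) = trans (update-< (ℕ.<′⇒< m<n)) (stage-limit m<n)

    limit-unary : ∀ n → U n (limit n)
    limit-unary n = proj₁ (proj₂ (stage (suc n))) (ℕ.n<1+n n)

    limit-binary : ∀ {m n} → m ℕ.< n → R m n (limit m) (limit n)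
    limit-binary {m} {n} m<n = subst (λ x → R m n x (limit n)) (stage-limit (ℕ.<⇒<′ (ℕ.m<n⇒m<1+n m<n)))
      (proj₂ (proj₂ (stage (suc n))) m<n (ℕ.n<1+n n))

-- Standard numbers and the labels of the vertices.

module Placement {ℓ} (em : ExcludedMiddle ℓ) (M : ArithStructure ℓ) (isPA : IsPAModel M)
                 (_⇀_ : ℕ → ℕ → Set ℓ) (acyclic : ∀ n → ¬ TransClosure _⇀_ n n) where
  open Arithmetic M isPA
  open Binary M isPA
  open Codes em M isPA

  Standard : C → Set ℓ
  Standard x = ∃[ k ] x ≡ numeral k

  standard-≤ : ∀ k {x} → x ≤ numeral k → Standard x
  standard-≤ k {x} p with ≤⇒<⊎≡ p
  standard-≤ k p | inj₂ e = k , e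
  standard-≤ zero p | inj₁ lt = contradiction lt (≮0 _)
  standard-≤ (suc k) p | inj₁ lt = standard-≤ k (<S⇒≤ lt)

  standard-down : ∀ {x y} → x ≤ y → Standard y → Standard x
  standard-down x≤y (k , refl) = standard-≤ k x≤y

  standard-+ : ∀ {x y} → Standard x → Standard y → Standard (x + y)
  standard-+ {x} hx (zero , refl) = subst Standard (sym (+-zero x)) hx
  standard-+ {x} hx (suc k , refl) =
    let n , e = standard-+ hx (k , refl)
    in suc n , trans (+-suc x _) (cong S# e)

  standard-suc : ∀ {x} → Standard x → Standard (S# x)
  standard-suc (k , refl) = suc k , refl

  standard-pow : ∀ {x} → Standard x → Standard (pow x)
  standard-pow (zero , refl) = 1 , pow-zero
  standard-pow (suc k , refl) =
    let h = standard-pow (k , refl)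
    in subst Standard (sym (pow-suc _)) (standard-+ h h)

  standard-< : ∀ {x c} → Standard x → ¬ Standard c → x < c
  standard-< {x} {c} hx hc with ≤⊎> c x
  ... | inj₂ lt = lt
  ... | inj₁ le = contradiction (standard-down le hx) hc

  Adjacent : ℕ → ℕ → Set ℓ
  Adjacent m n = (m ⇀ n) ⊎ (n ⇀ m)

  module Labels = Sequential {A = C} (λ _ → Standard) (λ m n x y → x < y × (IsBit x y ⟷ Adjacent m n))

  -- The sum `u` of `pow (f m)` over the earlier neighbours `m` of `n` has its bits in the right
  -- places. It is standard, being a sum of finitely many standard numbers.
  label-choice : ∀ n f → Labels.GoodBelow n f →
    ∃[ z ] (Standard z × (∀ {m} → m ℕ.< n → f m < z × (IsBit (f m) z ⟷ Adjacent m n)))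
  label-choice n f (standard , binary) =
    let u , std-u , bits , _ = neighbours n ℕ.≤-refl
        B , std-B , below = bound n ℕ.≤-refl
        -- `B'` is above all earlier labels, so adding `pow B'` leaves the bits at these positions
        -- alone and makes the new label exceed them.
        B' = B + u
        u< = ≤-<-trans (m≤n+m u B) (i<pow B')
    in u + pow B' , standard-+ std-u (standard-pow (standard-+ std-B std-u)) , λ m<n →
      let fm<B' = <-≤-trans (below m<n) (m≤m+n B u)
      in <-≤-trans (<-trans fm<B' (i<pow B')) (m≤n+m _ u) ,
         (λ b → proj₁ (bits m<n) (bit-+pow⁻ fm<B' b)) , (λ h → bit-+pow fm<B' (proj₂ (bits m<n) h))
    where
    increasing : ∀ {m k} → m ℕ.< k → k ℕ.< n → f m < f k
    increasing m<k k<n = proj₁ (binary m<k k<n)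

    -- The last clause keeps `u` below the powers still to be added, so that no carry occurs.
    Neighbours : ℕ → C → Set ℓ
    Neighbours k u = Standard u × (∀ {m} → m ℕ.< k → IsBit (f m) u ⟷ Adjacent m n) ×
                     (∀ {m} → k ℕ.≤ m → m ℕ.< n → u < pow (f m))

    add : ∀ {k u} → k ℕ.< n → Neighbours k u → Dec (Adjacent k n) → ∃[ u' ] Neighbours (suc k) u'
    add {k} {u} k<n (std , bits , small) (yes h) = u + pow (f k) , standard-+ std (standard-pow (standard k<n)) ,
      bits' , λ k<m m<n → <-≤-trans (m+powB<powSB (small ℕ.≤-refl k<n)) (pow-mono-≤ (<⇒S≤ (increasing k<m m<n)))
      where
      bits' : ∀ {m} → m ℕ.< suc k → IsBit (f m) (u + pow (f k)) ⟷ Adjacent m n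
      bits' m<Sk with ℕ.m<1+n⇒m<n∨m≡n m<Sk
      ... | inj₁ m<k = (λ b → proj₁ (bits m<k) (bit-+pow⁻ (increasing m<k k<n) b)) ,
                       (λ h → bit-+pow (increasing m<k k<n) (proj₂ (bits m<k) h))
      ... | inj₂ refl = (λ _ → h) , (λ _ → top-bit (small ℕ.≤-refl k<n))
    add {k} {u} k<n (std , bits , small) (no ¬h) = u , std , bits' , λ k<m m<n → small (ℕ.<⇒≤ k<m) m<n
      where
      bits' : ∀ {m} → m ℕ.< suc k → IsBit (f m) u ⟷ Adjacent m n
      bits' m<Sk with ℕ.m<1+n⇒m<n∨m≡n m<Sk
      ... | inj₁ m<k = bits m<k
      ... | inj₂ refl = (λ b → contradiction b (zeroBit⇒¬bit (<pow⇒zeroBit (small ℕ.≤-refl k<n)))) ,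
                        (λ h → contradiction h ¬h)

    neighbours : ∀ k → k ℕ.≤ n → ∃[ u ] Neighbours k u
    neighbours zero _ = 0# , (0 , refl) , (λ ()) , λ {m} _ _ → 0<pow (f m)
    neighbours (suc k) k<n = add k<n (proj₂ (neighbours k (ℕ.<⇒≤ k<n))) em

    bound : ∀ k → k ℕ.≤ n → ∃[ B ] (Standard B × (∀ {m} → m ℕ.< k → f m < B))
    bound zero _ = 0# , (0 , refl) , λ ()
    bound (suc k) k<n = let B , std , below = bound k (ℕ.<⇒≤ k<n) in
      B + S# (f k) , standard-+ std (standard-suc (standard k<n)) , λ m<Sk → below' below (ℕ.m<1+n⇒m<n∨m≡n m<Sk)
      where
      below' : ∀ {B m} → (∀ {m} → m ℕ.< k → f m < B) → m ℕ.< k ⊎ m ≡ k → f m < B + S# (f k)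
      below' {B} below (inj₁ m<k) = <-≤-trans (below m<k) (m≤m+n B _)
      below' {B} below (inj₂ refl) = <-≤-trans (x<Sx _) (m≤n+m _ B)

  abstract
    label : ℕ → C
    label = Labels.limit 0# label-choice

    label-standard : ∀ n → Standard (label n)
    label-standard = Labels.limit-unary 0# label-choice

    label-< : ∀ {m n} → m ℕ.< n → label m < label n
    label-< m<n = proj₁ (Labels.limit-binary 0# label-choice m<n)

    label-bit : ∀ {m n} → m ℕ.< n → IsBit (label m) (label n) ⟷ Adjacent m n
    label-bit m<n = proj₂ (Labels.limit-binary 0# label-choice m<n)

  label-injective : ∀ {m n} → label m ≡ label n → m ≡ n
  label-injective {m} {n} e with ℕ.<-cmp m n
  ... | tri< lt _ _ = contradiction e (<⇒≢ (label-< lt))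
  ... | tri≈ _ m≡n _ = m≡n
  ... | tri> _ _ gt = contradiction (sym e) (<⇒≢ (label-< gt))

  adjacent⇒rado : ∀ {m n} → Adjacent m n → Rado (label m) (label n)
  adjacent⇒rado {m} {n} h with ℕ.<-cmp m n
  ... | tri< lt _ _ = inj₁ (proj₂ (label-bit lt) h)
  ... | tri≈ _ refl _ = contradiction [ Sum.fromInj₁ (λ x → x) h ] (acyclic n)
  ... | tri> _ _ gt = inj₂ (proj₂ (label-bit gt) (Sum.swap h))

  bit⇒adjacent : ∀ {m n} → IsBit (label m) (label n) → Adjacent m n
  bit⇒adjacent {m} {n} b with ℕ.<-cmp m n
  ... | tri< lt _ _ = proj₁ (label-bit lt) b
  ... | tri≈ _ refl _ = contradiction (bit⇒< b) (<-irrefl _)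
  ... | tri> _ _ gt = contradiction (label-< gt) (<-asym (bit⇒< b))

  rado⇒adjacent : ∀ {m n} → Rado (label m) (label n) → Adjacent m n
  rado⇒adjacent (inj₁ b) = bit⇒adjacent b
  rado⇒adjacent (inj₂ b) = Sum.swap (bit⇒adjacent b)

  -- Levels separated by nonstandard gaps, and the embedding of a relation on ℕ.

  infix 4 _≪_ _⇀⁺_

  -- Vertices joined by a path are kept infinitely far apart in level, so that
  -- every later vertex still finds room between those already placed.
  _≪_ : C → C → Set ℓ
  x ≪ y = ∃[ g ] (¬ Standard g × x + g ≡ y)

  ≪⇒< : ∀ {x y} → x ≪ y → x < y
  ≪⇒< {x} (g , ns , e) with 0⊎S g
  ... | inj₁ refl = contradiction (0 , refl) ns
  ... | inj₂ (h , refl) = h , e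

  ≤-≪-trans : ∀ {x y z} → x ≤ y → y ≪ z → x ≪ z
  ≤-≪-trans {x} (u , refl) (g , ns , e) = u + g , (λ s → ns (standard-down (m≤n+m g u) s)) , trans (sym (+-assoc x u g)) e

  ≪-≤-trans : ∀ {x y z} → x ≪ y → y ≤ z → x ≪ z
  ≪-≤-trans {x} (g , ns , refl) (u , e) = g + u , (λ s → ns (standard-down (m≤m+n g u) s)) , trans (sym (+-assoc x g u)) e

  -- Half of a nonstandard gap, rounded either way, is nonstandard, because the standard numbers are
  -- closed under addition and successor.
  ≪-dense : ∀ {x y} → x ≪ y → ∃[ z ] (x ≪ z × z ≪ y)
  ≪-dense {x} (g , ns , e) = halve (parity g) ns e
    where
    halve : ∀ {g y} → ∃[ q ] (g ≡ q + q ⊎ g ≡ S# (q + q)) → ¬ Standard g → x + g ≡ y → ∃[ z ] (x ≪ z × z ≪ y)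
    halve (q , inj₁ refl) ns e = x + q , (q , nq , refl) , (q , nq , trans (+-assoc x q q) e)
      where nq = λ s → ns (standard-+ s s)
    halve (q , inj₂ refl) ns e = x + q , (q , nq , refl) ,
      (S# q , (λ s → nq (standard-down (<⇒≤ (x<Sx q)) s)) , trans (+-assoc x q _) (trans (cong (x +_) (+-suc q q)) e))
      where nq = λ s → ns (standard-suc (standard-+ s s))

  _⇀⁺_ : ℕ → ℕ → Set ℓ
  _⇀⁺_ = TransClosure _⇀_

  -- Serves for maxima and, with the reversed order, for minima. The default `d` is the result when
  -- no index below `n` satisfies `Q`.
  extremum : (_⊑_ : C → C → Set ℓ) → (∀ {x} → x ⊑ x) → (∀ {x y z} → x ⊑ y → y ⊑ z → x ⊑ z) →
             (∀ x y → x ⊑ y ⊎ y ⊑ x) → (Q : ℕ → Set ℓ) (f : ℕ → C) (d : C) → ∀ n →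
             ∃[ x ] ((x ≡ d ⊎ (∃[ m ] (m ℕ.< n × Q m × x ≡ f m))) × (∀ {m} → m ℕ.< n → Q m → f m ⊑ x))
  extremum _⊑_ ⊑-refl ⊑-trans ⊑-total Q f d = go
    where
    Attained Bounds : ℕ → C → Set ℓ
    Attained n x = x ≡ d ⊎ (∃[ m ] (m ℕ.< n × Q m × x ≡ f m))
    Bounds n x = ∀ {m} → m ℕ.< n → Q m → f m ⊑ x

    weaken : ∀ {n x} → Attained n x → Attained (suc n) x
    weaken (inj₁ e) = inj₁ e
    weaken (inj₂ (m , m<n , q , e)) = inj₂ (m , ℕ.m<n⇒m<1+n m<n , q , e)

    bounds-suc : ∀ {n x} → Bounds n x → (Q n → f n ⊑ x) → Bounds (suc n) x
    bounds-suc bounds last m<Sn q with ℕ.m<1+n⇒m<n∨m≡n m<Sn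
    ... | inj₁ m<n = bounds m<n q
    ... | inj₂ refl = last q

    go : ∀ n → ∃[ x ] (Attained n x × Bounds n x)
    go zero = d , inj₁ refl , λ ()
    go (suc n) = add (go n) em
      where
      add : ∃[ x ] (Attained n x × Bounds n x) → Dec (Q n) → ∃[ x ] (Attained (suc n) x × Bounds (suc n) x)
      add (x , x∈ , bounds) (no ¬q) = x , weaken x∈ , bounds-suc bounds (λ q → contradiction q ¬q)
      add (x , x∈ , bounds) (yes q) with ⊑-total (f n) x
      ... | inj₁ le = x , weaken x∈ , bounds-suc bounds (λ _ → le)
      ... | inj₂ ge = f n , inj₂ (n , ℕ.n<1+n n , q , refl) ,
                      bounds-suc (λ m<n q → ⊑-trans (bounds m<n q) ge) (λ _ → ⊑-refl)

  module Levelled (c : C) (nonstandard : ¬ Standard c) where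

    module Levels = Sequential {A = C} (λ _ x → 0# ≪ x × x ≪ c)
      (λ m n x y → (m ⇀⁺ n → x ≪ y) × (n ⇀⁺ m → y ≪ x))

    -- The new level goes between the highest level of the earlier vertices leading to `n` and the
    -- lowest level of those reached from `n`. Paths into and out of `n` compose, so these levels
    -- are already far apart.
    level-choice : ∀ n f → Levels.GoodBelow n f →
      ∃[ z ] ((0# ≪ z × z ≪ c) × (∀ {m} → m ℕ.< n → (m ⇀⁺ n → f m ≪ z) × (n ⇀⁺ m → z ≪ f m)))
    level-choice n f (unary , binary) =
      -- Where no such vertex exists, `0#` or `c` takes its place.
      let lo , lo∈ , above = extremum _≤_ ≤-refl ≤-trans ≤-total (_⇀⁺ n) f 0# n
          hi , hi∈ , below = extremum (flip _≤_) ≤-refl (flip ≤-trans) (flip ≤-total) (n ⇀⁺_) f c n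
          z , lo≪z , z≪hi = ≪-dense (gap lo∈ hi∈)
      in z , (≤-≪-trans (0≤ lo) lo≪z , ≪-≤-trans z≪hi (upper≤c hi∈)) ,
         λ m<n → (λ p → ≤-≪-trans (above m<n p) lo≪z) , (λ p → ≪-≤-trans z≪hi (below m<n p))
      where
      Lower Upper : C → Set ℓ
      Lower x = x ≡ 0# ⊎ (∃[ m ] (m ℕ.< n × m ⇀⁺ n × x ≡ f m))
      Upper x = x ≡ c ⊎ (∃[ m ] (m ℕ.< n × n ⇀⁺ m × x ≡ f m))

      upper≤c : ∀ {x} → Upper x → x ≤ c
      upper≤c (inj₁ refl) = ≤-refl
      upper≤c (inj₂ (_ , m<n , _ , refl)) = <⇒≤ (≪⇒< (proj₂ (unary m<n)))

      gap : ∀ {x y} → Lower x → Upper y → x ≪ y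
      gap (inj₁ refl) (inj₁ refl) = c , nonstandard , +-zeroˡ c
      gap (inj₁ refl) (inj₂ (_ , k<n , _ , refl)) = proj₁ (unary k<n)
      gap (inj₂ (_ , m<n , _ , refl)) (inj₁ refl) = proj₂ (unary m<n)
      gap (inj₂ (m , m<n , p , refl)) (inj₂ (k , k<n , q , refl)) with ℕ.<-cmp m k
      ... | tri< lt _ _ = proj₁ (binary lt k<n) (p ++ q)
      ... | tri≈ _ refl _ = contradiction (p ++ q) (acyclic m)
      ... | tri> _ _ gt = proj₂ (binary gt m<n) (p ++ q)

    abstract
      level : ℕ → C
      level = Levels.limit 0# level-choice

      level-≤ : ∀ n → level n ≤ c
      level-≤ n = <⇒≤ (≪⇒< (proj₂ (Levels.limit-unary 0# level-choice n)))

      level-< : ∀ {m n} → m ⇀ n → level m < level n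
      level-< {m} {n} h with ℕ.<-cmp m n
      ... | tri< lt _ _ = ≪⇒< (proj₁ (Levels.limit-binary 0# level-choice lt) [ h ])
      ... | tri≈ _ refl _ = contradiction [ h ] (acyclic m)
      ... | tri> _ _ gt = ≪⇒< (proj₂ (Levels.limit-binary 0# level-choice gt) [ h ])

    embedding : ∃[ j ] ((∀ {m n} → j m ≡ j n → m ≡ n) × (∀ {m n} → m ⇀ n ⟷ IsBit (j m) (j n)))
    -- `c` is the start and the height of the tower and, being above all labels, also the `K` of the
    -- codes.
    embedding = from (tower-function c c)
      where
      from : ∃[ T ] TowerFunction c c T →
             ∃[ j ] ((∀ {m n} → j m ≡ j n → m ≡ n) × (∀ {m n} → m ⇀ n ⟷ IsBit (j m) (j n)))
      from (T , c≤T , grows) = j , injective , edge , unedge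
        where
        label<c : ∀ n → label n < c
        label<c n = standard-< (label-standard n) nonstandard

        coded : ∀ n → ∃[ z ] Coded c (T (level n)) (label n) z
        coded n = code-at c (c≤T (level-≤ n)) (label<c n)

        j : ℕ → C
        j n = proj₁ (coded n)

        labelled : ∀ n → Labelled c (label n) (j n)
        labelled n = proj₁ (proj₂ (proj₂ (coded n)))

        injective : ∀ {m n} → j m ≡ j n → m ≡ n
        injective {m} {n} e = label-injective (label-unique c (label<c m) (label<c n) (labelled m)
          (subst (Labelled c (label n)) (sym e) (labelled n)))

        edge : ∀ {m n} → m ⇀ n → IsBit (j m) (j n)
        edge {m} {n} h = rado⇒bit c (label<c m) (proj₂ (coded n)) (labelled m)
          (<-≤-trans (proj₁ (proj₂ (coded m))) (grows (level-< h) (level-≤ n)))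
          (adjacent⇒rado (inj₂ h))

        unedge : ∀ {m n} → IsBit (j m) (j n) → m ⇀ n
        unedge {m} {n} b with rado⇒adjacent (bit⇒rado c (label<c m) (proj₂ (coded n)) (labelled m) b)
        ... | inj₁ n⇀m = contradiction (bit⇒< b) (<-asym (bit⇒< (edge n⇀m)))
        ... | inj₂ m⇀n = m⇀n

-- Acyclicity of models of KP.

module _ {ℓ} (N : BinaryStructure ℓ) where
  open SetSemantics N

  Entry : ∀ {n} → Carrier → Vec Carrier n → Set ℓ
  Entry x ρ = ∃[ i ] x ≡ lookup ρ i

  -- A disjunction of equations defining a finite class from parameters. The map `ι` lets the
  -- recursion pass to fewer indices in a fixed context.
  entry : ∀ {n m} → (Fin m → Fin n) → SetFormula (suc n)
  entry {m = zero} ι = false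
  entry {m = suc m} ι = atom (zero ≈' suc (ι zero)) ∨ entry (ι ∘ suc)

  entry-sound : ∀ {n m x} (ι : Fin m → Fin n) {ρ : Vec Carrier n} → Sat (entry ι) (x ∷ ρ) → ∃[ i ] x ≡ lookup ρ (ι i)
  entry-sound {m = suc m} ι (inj₁ e) = zero , e
  entry-sound {m = suc m} ι (inj₂ h) = let i , e = entry-sound (ι ∘ suc) h in suc i , e

  entry-complete : ∀ {n m x} (ι : Fin m → Fin n) {ρ : Vec Carrier n} i → x ≡ lookup ρ (ι i) → Sat (entry ι) (x ∷ ρ)
  entry-complete ι zero e = inj₁ e
  entry-complete ι (suc i) e = inj₂ (entry-complete (ι ∘ suc) i e)

  -- `ρ` lists the vertices of the path after the first. On a cycle `x` is itself the last of them,
  -- so no entry is minimal among the entries.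
  path-vertices : ∀ {x y} → TransClosure _∈_ x y → ∃[ n ] ∃[ ρ ]
    (Entry {n} y ρ × (∀ z → Entry z ρ → x ∈ z ⊎ (∃[ w ] (Entry w ρ × w ∈ z))))
  path-vertices {y = y} [ x∈y ] = 1 , y ∷ [] , (zero , refl) , λ { _ (zero , refl) → inj₁ x∈y }
  path-vertices {x} (_∷_ {y = y} x∈y p) with path-vertices p
  ... | n , ρ , (i , e) , pred = suc n , y ∷ ρ , (suc i , e) , pred'
    where
    pred' : ∀ z → Entry z (y ∷ ρ) → x ∈ z ⊎ (∃[ w ] (Entry w (y ∷ ρ) × w ∈ z))
    pred' _ (zero , refl) = inj₁ x∈y
    pred' z (suc i , e) with pred z (i , e)
    ... | inj₁ y∈z = inj₂ (y , (zero , refl) , y∈z)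
    ... | inj₂ (w , (j , e') , w∈z) = inj₂ (w , (suc j , e') , w∈z)

  KP⇒acyclic : IsKPModel N → Acyclic N
  KP⇒acyclic kp x p with path-vertices p
  ... | n , ρ , (i , e) , pred with IsKPModel.foundation kp (entry id) ρ (x , entry-complete id i e)
  ...   | z , z∈ρ , minimal with pred z (entry-sound id z∈ρ)
  ...     | inj₁ x∈z = contradiction (entry-complete id i e) (minimal x x∈z)
  ...     | inj₂ (w , (j , e') , w∈z) = contradiction (entry-complete id j e') (minimal w w∈z)

-- From relations on ℕ to countable structures.

module _ {ℓ} (em : ExcludedMiddle ℓ) (A B : BinaryStructure ℓ) where
  open BinaryStructure using (Carrier; _⇀_)

  injection⇒submodel : (f : Carrier A → Carrier B) → (∀ {x y} → f x ≡ f y → x ≡ y) →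
    (∀ {x y} → (_⇀_ A x y) ⟷ (_⇀_ B (f x) (f y))) → IsomorphicToSubmodel A B
  injection⇒submodel f injective edges = Image , g , record
    { isOrderMonomorphism = record
      { isOrderHomomorphism = record { cong = cong g ; mono = proj₁ edges }
      ; injective = λ e → injective (cong Refinement.value e)
      ; cancel = proj₂ edges }
    ; surjective = λ y → proj₁ (preimage y) , λ { refl → proj₂ (preimage y) } }
    where
    Image : Carrier B → Set _
    Image y = ∃[ x ] f x ≡ y

    g : Carrier A → Refinement.Refinement (Carrier B) Image
    g x = f x Refinement., irr (x , refl)

    -- Irrelevance of the membership proof prevents reading a preimage off it. Excluded middle
    -- supplies one, and the irrelevant proof only refutes the negative case.
    preimage : ∀ y → ∃[ x ] g x ≡ y
    preimage (y Refinement., irr h) with em {Image y}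
    ... | yes (x , refl) = x , refl
    ... | no ¬h = ⊥-elim-irr (¬h h)

module _ {ℓ} (G : BinaryStructure ℓ) (countable : Countable G) where
  open BinaryStructure G
  open Injection countable using () renaming (to to index; injective to index-injective)

  -- Numbers outside the range of `index` become isolated vertices, so all of ℕ serves as vertex
  -- set.
  _⇀ᵢ_ : ℕ → ℕ → Set ℓ
  m ⇀ᵢ n = ∃[ x ] ∃[ y ] (index x ≡ m × index y ≡ n × x ⇀ y)

  -- Consecutive edges come with separate preimages of their common vertex; injectivity of `index`
  -- identifies them.
  index-path : ∀ {m n} → TransClosure _⇀ᵢ_ m n → ∃[ x ] ∃[ y ] (index x ≡ m × index y ≡ n × TransClosure _⇀_ x y)
  index-path [ x , y , e , e' , h ] = x , y , e , e' , [ h ]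
  index-path ((x , y , e , refl , h) ∷ p) with index-path p
  ... | y' , z , e' , e'' , q with index-injective e'
  ...   | refl = x , z , e , e'' , h ∷ q

  index-acyclic : Acyclic G → ∀ n → ¬ TransClosure _⇀ᵢ_ n n
  index-acyclic acyclic n p with index-path p
  ... | x , y , e , e' , q with index-injective (trans e (sym e'))
  ...   | refl = acyclic x q

  index-edge : ∀ {x y} → (x ⇀ y) ⟷ (index x ⇀ᵢ index y)
  index-edge {x} {y} = (λ h → x , y , refl , refl , h) , back
    where
    back : index x ⇀ᵢ index y → x ⇀ y
    back (x' , y' , e , e' , h) with index-injective e | index-injective e'
    ... | refl | refl = h

acyclic⇒submodel : ∀ {ℓ} → ExcludedMiddle ℓ → (M : ArithStructure ℓ) → IsPAModel M → Nonstandard M →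
  (G : BinaryStructure ℓ) → Countable G → Acyclic G → IsomorphicToSubmodel G (HF M)
acyclic⇒submodel em M isPA (c , c≢) G countable acyclic =
  let j , injective , edges = Placement.Levelled.embedding em M isPA
        (_⇀ᵢ_ G countable) (index-acyclic G countable acyclic) c (λ (k , e) → c≢ k e)
  in injection⇒submodel em G (HF M) (j ∘ Injection.to countable) (Injection.injective countable ∘ injective)
       (proj₁ edges ∘ proj₁ (index-edge G countable) , proj₂ (index-edge G countable) ∘ proj₂ edges)

theorem3 : ∀ {ℓ} → ExcludedMiddle ℓ →
    (M : ArithStructure ℓ) → IsPAModel M → Nonstandard M →
    ((N : BinaryStructure ℓ) → IsKPModel N → Countable N → IsomorphicToSubmodel N (HF M))
    × ((G : BinaryStructure ℓ) → Countable G → Acyclic G → IsomorphicToSubmodel G (HF M))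
theorem3 em M isPA nonstandard =
  (λ N kp countable → acyclic⇒submodel em M isPA nonstandard N countable (KP⇒acyclic N kp)) ,
  acyclic⇒submodel em M isPA nonstandard
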